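{- Fix an integer $m\geq 1$. Let $\lambda\supset\mu$ be partitions of length at most $m$, choose $n\geq 1$ such that $\varpi_\lambda\in S_n$, and let $\varpi:=\varpi_\lambda\varpi_\mu^{ -1}$, the skew permutation associated to $(\lambda,\mu)$, so that $\ell(\varpi_\lambda)=\ell(\varpi)+\ell(\varpi_\mu)$. Then \[ \mathfrak{S}_{\varpi}(X,Y)=\sum_U (xy)^U, \] where the sum is over all $m$-bitableaux $U$ of shape $\lambda/\mu$.
   Context: $S_n$ is the symmetric group, generated by the simple transpositions $s_i=(i,i+1)$, $1\le i\le n-1$; $\ell(\varpi)$ is the length with respect to these generators, and a reduced word for $\varpi$ is a word $a_1\cdots a_r$ with $\varpi=s_{a_1}\cdots s_{a_r}$ and $r=\ell(\varpi)$. We write $\varpi_i:=\varpi(i)$. Let $\mathbb{A}_n$ be the nilCoxeter algebra: the unital associative $\mathbb{Z}$-algebra generated by $\xi_1,\ldots,\xi_{n-1}$ subject to the relations $\xi_i^2=0$, $\xi_i\xi_j=\xi_j\xi_i$ for $|i-j|\ge 2$, and $\xi_i\xi_{i+1}\xi_i=\xi_{i+1}\xi_i\xi_{i+1}$. For $\varpi\in S_n$, set $\xi_\varpi:=\xi_{a_1}\cdots\xi_{a_r}$ for any reduced word $a_1\cdots a_r$ of $\varpi$. The $\xi_\varpi$ form a $\mathbb{Z}$-basis, and $\langle\alpha,\varpi\rangle$ denotes the coefficient of $\xi_\varpi$ in $\alpha$. For an indeterminate $t$, set $A_i(t):=(1+t\xi_{n-1})(1+t\xi_{n-2})\cdots(1+t\xi_i)$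 and $\tilde A_i(t):=(1-t\xi_i)(1-t\xi_{i+1})\cdots(1-t\xi_{n-1})$. For commuting variables $X=(x_1,x_2,\ldots)$, $Y=(y_1,y_2,\ldots)$, the double Schubert polynomial of $\varpi\in S_n$ is \[ \mathfrak{S}_\varpi(X,Y):=\big\langle \tilde A_{n-1}(y_{n-1})\cdots\tilde A_1(y_1)A_1(x_1)\cdots A_{n-1}(x_{n-1}),\varpi\big\rangle \] (this is independent of $n$). A partition is identified with its Young diagram (left-justified rows, $\lambda_i$ boxes in row $i$); $\lambda/\mu$ is the set of boxes of $\lambda$ not in $\mu$. For a partition $\lambda$ of length at most $m$, the $m$-Grassmannian permutation $\varpi_\lambda$ is defined by $\varpi_\lambda(i)=\lambda_{m+1-i}+i$ for $1\le i\le m$, with $\varpi_\lambda(m+1)<\varpi_\lambda(m+2)<\cdots$ being the remaining positive integers in increasing order. Let $\mathbf{P}$ be the ordered alphabet $(n-1)'<\cdots<1'<1<\cdots<n-1$; primed symbols are marked, the others unmarked. An $m$-bitableau of shape $\lambda/\mu$ is a filling of the boxes of $\lambda/\mu$ with elements of $\mathbf{P}$, weakly increasing along each row and down each column, such that (i) marked entries are strictly increasing down each column and unmarked entries are strictly increasing along each row, and (ii) for each $i\in[1,m]$, the entries in row $i$ lie in the interval $[(\mu_i+m+1-i)',\ \lambda_i+m-i]$ of $\mathbf{P}$. For such $U$, $(xy)^U:=\prod_i x_i^{n_i'}\prod_i(-y_i)^{n_i}$, where $n_i'$ (resp. $n_i$) is the number of times $i'$ (resp. $i$) appears in $U$. 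-}

module Defs where

open import Level using (Level)
open import Data.Nat using (ℕ; zero; suc; _+_; _∸_; _≤_; _<_; _<?_)
open import Data.Nat.Properties using () renaming (_≟_ to _≟ℕ_)
open import Data.List using (List; []; _∷_; _++_; map; concatMap; reverse; foldl; foldr; filter; concat; upTo)
import Data.List.Properties as LP
open import Data.List.Membership.DecPropositional _≟ℕ_ using (_∈?_)
open import Data.Vec using (Vec; []; _∷_)
open import Data.Product using (_×_; _,_)
open import Relation.Nullary using (¬_; does; ¬?)
open import Relation.Binary.PropositionalEquality using (_≡_; _≢_)
open import Data.Bool using (if_then_else_)
open import Algebra.Bundles using (CommutativeRing)

ivl : ℕ → ℕ → List ℕ
ivl a b = map (a +_) (upTo (suc b ∸ a))

lookupD : {A : Set} → A → List A → ℕ → A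
lookupD d []       _       = d
lookupD d (x ∷ xs) zero    = x
lookupD d (x ∷ xs) (suc k) = lookupD d xs k

-- Permutations of S_n in one-line notation: the list [w(1), ..., w(n)].

Perm : Set
Perm = List ℕ

idPerm : ℕ → Perm
idPerm n = ivl 1 n

val : Perm → ℕ → ℕ
val w i = lookupD 0 w (i ∸ 1)

swapAt : Perm → ℕ → Perm
swapAt (a ∷ b ∷ r) zero    = b ∷ a ∷ r
swapAt (a ∷ r)     (suc k) = a ∷ swapAt r k
swapAt w           _       = w

-- w s_i  (as functions, (w s_i)(j) = w(s_i(j))): swap positions i and i+1
rmulS : Perm → ℕ → Perm
rmulS w i = swapAt w (i ∸ 1)

posOf : ℕ → Perm → ℕ
posOf k []       = 0
posOf k (a ∷ w)  = if does (k ≟ℕ a) then 1 else suc (posOf k w)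

invPerm : ℕ → Perm → Perm
invPerm n w = map (λ k → posOf k w) (ivl 1 n)

compose : Perm → Perm → Perm
compose u v = map (val u) v

-- Partitions of length at most m: Vec ℕ m, padded with zeros.

part : {m : ℕ} → Vec ℕ m → ℕ → ℕ
part v        zero          = 0
part []       (suc i)       = 0
part (x ∷ v)  (suc zero)    = x
part (x ∷ v)  (suc (suc i)) = part v (suc i)

IsPartition : {m : ℕ} → Vec ℕ m → Set
IsPartition la = ∀ i → part la (suc (suc i)) ≤ part la (suc i)

Contains : {m : ℕ} → Vec ℕ m → Vec ℕ m → Set
Contains la mu = ∀ i → part mu i ≤ part la i

grassFirst : (m : ℕ) → Vec ℕ m → List ℕ
grassFirst m la = map (λ i → part la (suc m ∸ i) + i) (ivl 1 m)

grass : (m n : ℕ) → Vec ℕ m → Perm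
grass m n la = grassFirst m la ++ filter (λ k → ¬? (k ∈? grassFirst m la)) (ivl 1 n)

skewPerm : (m n : ℕ) → Vec ℕ m → Vec ℕ m → Perm
skewPerm m n la mu = compose (grass m n la) (invPerm n (grass m n mu))

-- NilCoxeter algebra A_n with coefficients in a commutative ring R,
-- realised in its Z-basis {ξ_w}: an element is a formal sum,
-- a list of (w , coefficient).  Right multiplication by a generator:
--   ξ_w ξ_i = ξ_{w s_i}  if ℓ(w s_i) = ℓ(w)+1  (i.e. w(i) < w(i+1)),  else 0.

module NilCoxeter {c ℓ : Level} (R : CommutativeRing c ℓ) where
  open CommutativeRing R using (Carrier; 0#; 1#; -_) renaming (_+_ to _+R_; _*_ to _*R_)

  Elem : Set c
  Elem = List (Perm × Carrier)

  one : ℕ → Elem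
  one n = (idPerm n , 1#) ∷ []

  rmulFactor : Carrier → ℕ → Elem → Elem
  rmulFactor t i = concatMap step
    where
    step : Perm × Carrier → Elem
    step (w , a) = (w , a) ∷ (if does (val w i <? val w (suc i))
                                 then (rmulS w i , a *R t) ∷ []
                                 else [])

  coeff : Elem → Perm → Carrier
  coeff []             v = 0#
  coeff ((w , a) ∷ α)  v = if does (LP.≡-dec _≟ℕ_ w v) then a +R coeff α v else coeff α v

  -- the factors, left to right, of
  --  Ã_{n-1}(y_{n-1}) ⋯ Ã_1(y_1) A_1(x_1) ⋯ A_{n-1}(x_{n-1}),
  -- a factor (t , i) standing for (1 + t ξ_i).
  -- Ã_k(t) = (1 - t ξ_k)(1 - t ξ_{k+1}) ⋯ (1 - t ξ_{n-1})
  -- A_k(t) = (1 + t ξ_{n-1}) ⋯ (1 + t ξ_k)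
  factors : ℕ → (ℕ → Carrier) → (ℕ → Carrier) → List (Carrier × ℕ)
  factors n x y =
    concatMap (λ k → map (λ i → (- (y k) , i)) (ivl k (n ∸ 1))) (reverse (ivl 1 (n ∸ 1)))
    ++ concatMap (λ k → map (λ i → (x k , i)) (reverse (ivl k (n ∸ 1)))) (ivl 1 (n ∸ 1))

  product : ℕ → (ℕ → Carrier) → (ℕ → Carrier) → Elem
  product n x y = foldl (λ α f → rmulFactor (Data.Product.proj₁ f) (Data.Product.proj₂ f) α)
                        (one n) (factors n x y)

  doubleSchubert : ℕ → (ℕ → Carrier) → (ℕ → Carrier) → Perm → Carrier
  doubleSchubert n x y w = coeff (product n x y) w

data Letter : Set where
  marked   : ℕ → Letter
  unmarked : ℕ → Letter

data _≤P_ : Letter → Letter → Set where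
  m≤m : {a b : ℕ} → b ≤ a → marked a ≤P marked b
  m≤u : {a b : ℕ} → marked a ≤P unmarked b
  u≤u : {a b : ℕ} → a ≤ b → unmarked a ≤P unmarked b

data InP (n : ℕ) : Letter → Set where
  inM : {i : ℕ} → 1 ≤ i → suc i ≤ n → InP n (marked i)
  inU : {i : ℕ} → 1 ≤ i → suc i ≤ n → InP n (unmarked i)

IsMarked : Letter → Set
IsMarked (marked _)   = Data.Unit.⊤ where import Data.Unit
IsMarked (unmarked _) = Data.Empty.⊥ where import Data.Empty

IsUnmarked : Letter → Set
IsUnmarked (marked _)   = Data.Empty.⊥ where import Data.Empty
IsUnmarked (unmarked _) = Data.Unit.⊤ where import Data.Unit

-- Fillings of λ/μ: a list of m rows; row i (1-based) lists the entries of
-- the boxes (i, μ_i + 1), …, (i, λ_i) from left to right.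

Filling : Set
Filling = List (List Letter)

row : Filling → ℕ → List Letter
row U i = lookupD [] U (i ∸ 1)

-- entry in box (i, j) (meaningful only for boxes of λ/μ)
entry : {m : ℕ} → Vec ℕ m → Filling → ℕ → ℕ → Letter
entry mu U i j = lookupD (unmarked 0) (row U i) (j ∸ suc (part mu i))

Box : (m : ℕ) → Vec ℕ m → Vec ℕ m → ℕ → ℕ → Set
Box m la mu i j = (1 ≤ i) × (i ≤ m) × (part mu i < j) × (j ≤ part la i)

len : {A : Set} → List A → ℕ
len = Data.List.length

record IsBitableau (n m : ℕ) (la mu : Vec ℕ m) (U : Filling) : Set where
  field
    rowsCount : len U ≡ m
    rowLength : ∀ i → 1 ≤ i → i ≤ m → len (row U i) ≡ part la i ∸ part mu i
    inAlphabet : ∀ i j → Box m la mu i j → InP n (entry mu U i j)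
    rowWeak   : ∀ i j j' → Box m la mu i j → Box m la mu i j' → j < j' →
                entry mu U i j ≤P entry mu U i j'
    rowStrict : ∀ i j j' → Box m la mu i j → Box m la mu i j' → j < j' →
                IsUnmarked (entry mu U i j) → IsUnmarked (entry mu U i j') →
                entry mu U i j ≢ entry mu U i j'
    colWeak   : ∀ i i' j → Box m la mu i j → Box m la mu i' j → i < i' →
                entry mu U i j ≤P entry mu U i' j
    colStrict : ∀ i i' j → Box m la mu i j → Box m la mu i' j → i < i' →
                IsMarked (entry mu U i j) → IsMarked (entry mu U i' j) →
                entry mu U i j ≢ entry mu U i' j
    rowLower : ∀ i j → Box m la mu i j →
               marked (part mu i + m + 1 ∸ i) ≤P entry mu U i j
    rowUpper : ∀ i j → Box m la mu i j →
               entry mu U i j ≤P unmarked (part la i + m ∸ i)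

module Weights {c ℓ : Level} (R : CommutativeRing c ℓ) where
  open CommutativeRing R using (Carrier; 0#; 1#; -_) renaming (_+_ to _+R_; _*_ to _*R_)

  letterWeight : (ℕ → Carrier) → (ℕ → Carrier) → Letter → Carrier
  letterWeight x y (marked i)   = x i
  letterWeight x y (unmarked i) = - (y i)

  weight : (ℕ → Carrier) → (ℕ → Carrier) → Filling → Carrier
  weight x y U = foldr (λ l r → letterWeight x y l *R r) 1# (concat U)

  sumR : List Carrier → Carrier
  sumR = foldr _+R_ 0#

-- Peeling factors off the right end of the product turns v into v s_i at every chosen factor,
-- which must be a descent of v.  For v = ϖ_λ ϖ_μ⁻¹ the descents are exactly the indices i such that
-- a box of content index i (m + column − row) can be added to μ inside λ, and v s_i is then the skew
-- permutation of λ and the enlarged μ.  The coefficient is therefore a sum over the ways of building λ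
-- from μ box by box along the sequence of factors.  Labelling each box with the variable of its factor
-- gives the bitableaux: a factor A_k(x_k) adds a horizontal strip, labelled k′, and Ã_k(y_k) a vertical
-- strip, labelled k.  The strips avoid all content indices below k, which is the flagging condition.

module Submission where

open import Defs
open import Level using (Level)
open import Data.Bool using (if_then_else_)
open import Data.Nat as ℕ using (ℕ; zero; suc; _≤_; _<_; _>_; _<?_; z≤n; s≤s)
import Data.Nat.Properties as ℕ
open import Data.List using (List; []; _∷_; _++_; map; foldr; foldl; filter; concatMap; replicate; reverse; length; iterate; applyUpTo)
import Data.List.Properties as List
open import Data.List.Membership.Propositional using (_∈_; _∉_; lose; find)
open import Data.List.Membership.Propositional.Properties
open import Data.List.Membership.Propositional.Properties.WithK using (unique∧set⇒bag)
open import Data.List.Membership.DecPropositional ℕ._≟_ using (_∈?_)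
open import Data.List.Relation.Binary.BagAndSetEquality using (∼bag⇒↭)
open import Data.List.Relation.Binary.Permutation.Propositional as ↭ using (_↭_)
open import Data.List.Relation.Unary.All as All using (All; []; _∷_)
import Data.List.Relation.Unary.All.Properties as All
open import Data.List.Relation.Unary.AllPairs as AllPairs using (AllPairs; []; _∷_)
import Data.List.Relation.Unary.AllPairs.Properties as AllPairs
open import Data.List.Relation.Unary.Any using (Any; here; there; satisfied)
import Data.List.Relation.Unary.Any.Properties as Any
open import Data.List.Relation.Unary.Unique.Propositional using (Unique)
import Data.List.Relation.Unary.Unique.Propositional.Properties as Unique
open import Data.Vec as Vec using (Vec; []; _∷_)
import Data.Vec.Properties as Vec
open import Data.Product using (_×_; _,_; proj₁; proj₂; ∃; ∃-syntax)
open import Data.Sum using (_⊎_; inj₁; inj₂)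
open import Data.Empty using (⊥-elim)
open import Function using (_∘_; id; flip)
open import Function.Bundles using (_⇔_; mk⇔; module Equivalence)
open import Relation.Nullary using (¬_; Dec; yes; no; ¬?; does)
open import Relation.Nullary.Decidable using (_×-dec_; dec-true; dec-false)
open import Relation.Binary.Definitions using (tri<; tri≈; tri>)
import Relation.Binary.PropositionalEquality as ≡
open ≡ using (_≡_; _≢_)
open import Algebra.Bundles using (CommutativeRing)

-- The obstacle is to read descents off a product with an inverse. The first m values of ϖ_μ are
-- treated as beads: a box of content index i moves one bead from i to the empty place i + 1, that
-- is, it replaces ϖ_μ by s_i ϖ_μ. Going from μ up to λ, where the skew permutation is the identity,
-- beads only rise and the other values only fall, each kind keeping its order. Hence a descent at i
-- needs a bead at i and none at i + 1, and the bead must still have room to rise.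
--
-- The second point is that no filling is produced twice. Factors are ordered by pairs of a letter
-- and an index, and the smallest pair occurring in a filling sits on the only addable box of that
-- index, so the filling determines the order of its construction. For equal letters the order
-- compares indices, upwards for marked and downwards for unmarked letters. Contents grow along rows
-- and fall down columns, so this tie-break is exactly what permits equal marked entries in rows
-- only and equal unmarked entries in columns only.

module Combinatorics where
  open import Data.Nat using (_+_; _∸_)
  open import Data.Nat.Properties
  open import Data.List.Properties
  open ≡ hiding (_≡_; _≢_)
  open Equivalence using (to; from)

  -- Simple transpositions on values and on one-line words

  transp : ℕ → ℕ → ℕ
  transp i x with x ≟ i | x ≟ suc i
  ... | yes _ | _     = suc i
  ... | no _  | yes _ = i
  ... | no _  | no _  = x

  transp-i : ∀ i → transp i i ≡ suc i
  transp-i i with i ≟ i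
  ... | yes _  = refl
  ... | no i≢i = ⊥-elim (i≢i refl)

  transp-suc : ∀ i → transp i (suc i) ≡ i
  transp-suc i with suc i ≟ i | suc i ≟ suc i
  ... | yes e | _    = ⊥-elim (1+n≢n e)
  ... | no _ | yes _ = refl
  ... | no _ | no ne = ⊥-elim (ne refl)

  transp-other : ∀ {i x} → x ≢ i → x ≢ suc i → transp i x ≡ x
  transp-other {i} {x} p q with x ≟ i | x ≟ suc i
  ... | yes e | _     = ⊥-elim (p e)
  ... | no _  | yes e = ⊥-elim (q e)
  ... | no _  | no _  = refl

  transp-involutive : ∀ i x → transp i (transp i x) ≡ x
  transp-involutive i x with x ≟ i | x ≟ suc i
  ... | yes refl | _     = transp-suc i
  ... | no _  | yes refl = transp-i i
  ... | no p  | no q     = transp-other p q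

  transp-injective : ∀ i {x z} → transp i x ≡ transp i z → x ≡ z
  transp-injective i {x} {z} e =
    trans (sym (transp-involutive i x)) (trans (cong (transp i) e) (transp-involutive i z))

  -- The only pair that s_i inverts is i, i + 1, and it contains i. This is applied to values that
  -- are not beads, while i is one.
  transp-<-mono : ∀ {i x z} → x ≢ i → z ≢ i → x < z → transp i x < transp i z
  transp-<-mono {i} {x} {z} x≢i z≢i x<z with x ≟ i | x ≟ suc i | z ≟ i | z ≟ suc i
  ... | yes e | _ | _ | _ = ⊥-elim (x≢i e)
  ... | _ | _ | yes e | _ = ⊥-elim (z≢i e)
  ... | no _ | yes refl | no _ | yes refl = ⊥-elim (<-irrefl refl x<z)
  ... | no _ | yes refl | no _ | no _ = ≤-trans (n≤1+n _) x<z
  ... | no _ | no _ | no _ | yes refl = ≤∧≢⇒< (≤-pred x<z) x≢i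
  ... | no _ | no _ | no _ | no _ = x<z

  -- Unlike `ivl`, which maps over `upTo`, this unfolds one element at a time, so the interval can
  -- be cut around the two neighbours that s_i exchanges.
  range : ℕ → ℕ → List ℕ
  range = iterate suc

  applyUpTo-range : ∀ (f : ℕ → ℕ) a l → (∀ x → f x ≡ a + x) → applyUpTo f l ≡ range a l
  applyUpTo-range f a zero    f≗ = refl
  applyUpTo-range f a (suc l) f≗ = cong₂ _∷_ (trans (f≗ 0) (+-identityʳ a))
    (applyUpTo-range (f ∘ suc) (suc a) l λ x → trans (f≗ (suc x)) (+-suc a x))

  ivl≡range : ∀ a b → ivl a b ≡ range a (suc b ∸ a)
  ivl≡range a b = trans (map-upTo (a +_) (suc b ∸ a)) (applyUpTo-range (a +_) a _ λ _ → refl)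

  range-++ : ∀ a k l → range a (k + l) ≡ range a k ++ range (k + a) l
  range-++ a zero    l = refl
  range-++ a (suc k) l = cong (a ∷_)
    (trans (range-++ (suc a) k l) (cong (λ b → range (suc a) k ++ range b l) (+-suc k a)))

  All-range : ∀ a l → All (λ x → a ≤ x × x < a + l) (range a l)
  All-range a zero    = []
  All-range a (suc l) = (≤-refl , subst (a <_) (sym (+-suc a l)) (s≤s (m≤m+n a l))) ∷
    All.map (λ { {x} (p , q) → ≤-trans (n≤1+n a) p , subst (x <_) (sym (+-suc a l)) q }) (All-range (suc a) l)

  range-split : ∀ p {n} → suc p < n →
    ∃[ q ] range 1 n ≡ range 1 p ++ suc p ∷ suc (suc p) ∷ range (3 + p) q
  range-split p {n} lt with m≤n⇒∃[o]m+o≡n lt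
  ... | q , refl = q , trans (cong (range 1) (trans (cong suc (sym (+-suc p q))) (sym (+-suc p (suc q)))))
    (trans (range-++ 1 p (suc (suc q)))
      (cong (λ b → range 1 p ++ b ∷ suc b ∷ range (suc (suc b)) q) (+-comm p 1)))

  lookupD-map-range : (d : ℕ) (f : ℕ → ℕ) → ∀ a l p → p < l → lookupD d (map f (range a l)) p ≡ f (p + a)
  lookupD-map-range d f a (suc l) zero    _       = refl
  lookupD-map-range d f a (suc l) (suc p) (s≤s h) =
    trans (lookupD-map-range d f (suc a) l p h) (cong f (+-suc p a))

  swapAt-++ : ∀ as {a b bs} → swapAt (as ++ a ∷ b ∷ bs) (length as) ≡ as ++ b ∷ a ∷ bs
  swapAt-++ []           = refl
  swapAt-++ (c ∷ [])     = cong (c ∷_) (swapAt-++ [])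
  swapAt-++ (c ∷ d ∷ as) = cong (c ∷_) (swapAt-++ (d ∷ as))

  length-swapAt : ∀ w p → length (swapAt w p) ≡ length w
  length-swapAt []          zero    = refl
  length-swapAt []          (suc p) = refl
  length-swapAt (a ∷ [])    zero    = refl
  length-swapAt (a ∷ b ∷ w) zero    = refl
  length-swapAt (a ∷ [])    (suc p) = cong suc (length-swapAt [] p)
  length-swapAt (a ∷ b ∷ w) (suc p) = cong suc (length-swapAt (b ∷ w) p)

  swapAt-involutive : ∀ w p → swapAt (swapAt w p) p ≡ w
  swapAt-involutive []          zero    = refl
  swapAt-involutive []          (suc p) = refl
  swapAt-involutive (a ∷ [])    zero    = refl
  swapAt-involutive (a ∷ b ∷ w) zero    = refl
  swapAt-involutive (a ∷ [])    (suc p) = cong (a ∷_) (swapAt-involutive [] p)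
  swapAt-involutive (a ∷ b ∷ w) (suc p) = cons (swapAt (b ∷ w) p) refl
    where
    -- `swapAt` inspects the tail before the index, so it is stuck on a tail that is itself a
    -- `swapAt`. Generalising that tail to `u` lets both shapes reduce.
    cons : ∀ u → u ≡ swapAt (b ∷ w) p → swapAt (a ∷ u) (suc p) ≡ a ∷ b ∷ w
    cons []      e = cong (a ∷_) (trans (cong (λ u → swapAt u p) e) (swapAt-involutive (b ∷ w) p))
    cons (_ ∷ _) e = cong (a ∷_) (trans (cong (λ u → swapAt u p) e) (swapAt-involutive (b ∷ w) p))

  lookupD-swapAt : ∀ d w p → suc p < length w →
    lookupD d (swapAt w p) p ≡ lookupD d w (suc p) × lookupD d (swapAt w p) (suc p) ≡ lookupD d w p
  lookupD-swapAt d (a ∷ b ∷ w) zero    _       = refl , refl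
  lookupD-swapAt d (a ∷ b ∷ w) (suc p) (s≤s h) = lookupD-swapAt d (b ∷ w) p h
  lookupD-swapAt d (a ∷ [])    p       (s≤s ())

  swapAt-map-range : ∀ (f : ℕ → ℕ) p {n} → suc p < n →
    swapAt (map f (range 1 n)) p ≡ map (f ∘ transp (suc p)) (range 1 n)
  swapAt-map-range f p {n} lt with range-split p lt
  ... | q , e rewrite e = go
    where
    A = range 1 p
    B = range (3 + p) q
    A≡ : map (f ∘ transp (suc p)) A ≡ map f A
    A≡ = map-cong-local (All.map (λ { (_ , x<) → cong f (transp-other (<⇒≢ x<) (<⇒≢ (m<n⇒m<1+n x<))) })
           (All-range 1 p))
    B≡ : map (f ∘ transp (suc p)) B ≡ map f B
    B≡ = map-cong-local (All.map (λ { (<x , _) → cong f (transp-other (>⇒≢ (≤-trans (n≤1+n _) <x)) (>⇒≢ <x)) })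
           (All-range (3 + p) q))
    go : swapAt (map f (A ++ suc p ∷ suc (suc p) ∷ B)) p
         ≡ map (f ∘ transp (suc p)) (A ++ suc p ∷ suc (suc p) ∷ B)
    go = begin
      swapAt (map f (A ++ suc p ∷ suc (suc p) ∷ B)) p
        ≡⟨ cong₂ swapAt (map-++ f A _) (sym (trans (length-map f A) (length-iterate suc 1 p))) ⟩
      swapAt (map f A ++ f (suc p) ∷ f (suc (suc p)) ∷ map f B) (length (map f A))
        ≡⟨ swapAt-++ (map f A) ⟩
      map f A ++ f (suc (suc p)) ∷ f (suc p) ∷ map f B
        ≡⟨ cong₂ _++_ (sym A≡) (cong₂ _∷_ (cong f (sym (transp-i (suc p))))
             (cong₂ _∷_ (cong f (sym (transp-suc (suc p)))) (sym B≡))) ⟩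
      map (f ∘ transp (suc p)) A ++ map (f ∘ transp (suc p)) (suc p ∷ suc (suc p) ∷ B)
        ≡⟨ map-++ (f ∘ transp (suc p)) A _ ⟨
      map (f ∘ transp (suc p)) (A ++ suc p ∷ suc (suc p) ∷ B) ∎
      where open ≡-Reasoning

  ∈-ivl⇔ : ∀ {a b x} → x ∈ ivl a b ⇔ (a ≤ x × x ≤ b)
  ∈-ivl⇔ {a} {b} {x} = mk⇔ bounds member
    where
    bounds : x ∈ ivl a b → a ≤ x × x ≤ b
    bounds x∈ with ∈-map⁻ (a +_) x∈
    ... | r , r∈ , refl = m≤m+n a r ,
      ≮⇒≥ (λ h → <⇒≱ (∈-upTo⁻ r∈) (m≤n+o⇒m∸n≤o (suc b) a h))
    member : a ≤ x × x ≤ b → x ∈ ivl a b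
    member (a≤x , x≤b) = subst (_∈ ivl a b) (m+[n∸m]≡n a≤x) (∈-map⁺ (a +_) (∈-upTo⁺ (∸-monoˡ-< (s≤s x≤b) a≤x)))

  -- Partitions and beads

  increment : ∀ {m} → ℕ → Vec ℕ m → Vec ℕ m
  increment k       []      = []
  increment zero    (x ∷ v) = suc x ∷ v
  increment (suc k) (x ∷ v) = x ∷ increment k v

  part-increment : ∀ {m} k (v : Vec ℕ m) → k < m → part (increment k v) (suc k) ≡ suc (part v (suc k))
  part-increment zero    (x ∷ v) _       = refl
  part-increment (suc k) (x ∷ v) (s≤s h) = part-increment k v h

  part-increment-≢ : ∀ {m} k j (v : Vec ℕ m) → j ≢ k → part (increment k v) (suc j) ≡ part v (suc j)
  part-increment-≢ k       j       []      _  = refl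
  part-increment-≢ zero    zero    (x ∷ v) ne = ⊥-elim (ne refl)
  part-increment-≢ zero    (suc j) (x ∷ v) _  = refl
  part-increment-≢ (suc k) zero    (x ∷ v) _  = refl
  part-increment-≢ (suc k) (suc j) (x ∷ v) ne = part-increment-≢ k j v (ne ∘ cong suc)

  part-extensional : ∀ {m} (u v : Vec ℕ m) → (∀ j → j < m → part u (suc j) ≡ part v (suc j)) → u ≡ v
  part-extensional []      []      _ = refl
  part-extensional (x ∷ u) (z ∷ v) h =
    cong₂ _∷_ (h 0 (s≤s z≤n)) (part-extensional u v λ j j< → h (suc j) (s≤s j<))

  part-antitone : ∀ {m} (v : Vec ℕ m) → IsPartition v → ∀ {j k} → j ≤ k → part v (suc k) ≤ part v (suc j)
  part-antitone v pv {j} {zero}  z≤n = ≤-refl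
  part-antitone v pv {j} {suc k} j≤k with m≤n⇒m<n∨m≡n j≤k
  ... | inj₁ (s≤s h) = ≤-trans (pv k) (part-antitone v pv h)
  ... | inj₂ refl    = ≤-refl

  sum-increment : ∀ {m} k (v : Vec ℕ m) → k < m → Vec.sum (increment k v) ≡ suc (Vec.sum v)
  sum-increment zero    (x ∷ v) _       = refl
  sum-increment (suc k) (x ∷ v) (s≤s h) = trans (cong (x +_) (sum-increment k v h)) (+-suc x _)

  sum-mono : ∀ {m} (u v : Vec ℕ m) → (∀ j → part u (suc j) ≤ part v (suc j)) → Vec.sum u ≤ Vec.sum v
  sum-mono []      []      _ = z≤n
  sum-mono (x ∷ u) (z ∷ v) h = +-mono-≤ (h 0) (sum-mono u v (h ∘ suc))

  -- With rows indexed from 0, bead v k is the value of the Grassmannian permutation at m ∸ k,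
  -- and also the index m + column − row of the first box to the right of row k.
  bead : ∀ {m} → Vec ℕ m → ℕ → ℕ
  bead {m} v k = part v (suc k) + (m ∸ k)

  module _ {m} (v : Vec ℕ m) (pv : IsPartition v) where

    bead-antitone : ∀ {j k} → j < k → k < m → bead v k < bead v j
    bead-antitone j<k k<m = +-mono-≤-< (part-antitone v pv (<⇒≤ j<k)) (∸-monoʳ-< j<k (<⇒≤ k<m))

    bead-injective : ∀ {j k} → j < m → k < m → bead v j ≡ bead v k → j ≡ k
    bead-injective {j} {k} j<m k<m e with <-cmp j k
    ... | tri< j<k _ _ = ⊥-elim (<⇒≢ (bead-antitone j<k k<m) (sym e))
    ... | tri≈ _ e′ _  = e′
    ... | tri> _ _ k<j = ⊥-elim (<⇒≢ (bead-antitone k<j j<m) e)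

  bead-pos : ∀ {m} (v : Vec ℕ m) {k} → k < m → 0 < bead v k
  bead-pos v k<m = ≤-trans (m<n⇒0<n∸m k<m) (m≤n+m _ _)

  ∈-ivl⁻ : ∀ {m x} → x ∈ ivl 1 m → ∃[ j ] j < m × x ≡ m ∸ j × suc m ∸ x ≡ suc j
  ∈-ivl⁻ {m} x∈ with ∈-map⁻ suc x∈
  ... | r , r∈ , refl with ∈-upTo⁻ r∈
  ... | r<m = m ∸ suc r , ∸-monoʳ-< (s≤s z≤n) r<m , sym (m∸[m∸n]≡n r<m) , +-∸-assoc 1 r<m

  ∈-grassFirst⁺ : ∀ {m} (v : Vec ℕ m) {k} → k < m → bead v k ∈ grassFirst m v
  ∈-grassFirst⁺ {m} v {k} k<m =
    subst (_∈ grassFirst m v)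
      (cong (λ r → part v r + (m ∸ k)) (trans (+-∸-assoc 1 (m∸n≤m m k)) (cong suc (m∸[m∸n]≡n (<⇒≤ k<m)))))
      (∈-map⁺ (λ i → part v (suc m ∸ i) + i) (from ∈-ivl⇔ (m<n⇒0<n∸m k<m , m∸n≤m m k)))

  ∈-grassFirst⁻ : ∀ {m} (v : Vec ℕ m) {x} → x ∈ grassFirst m v → ∃[ k ] k < m × x ≡ bead v k
  ∈-grassFirst⁻ {m} v x∈ with ∈-map⁻ (λ i → part v (suc m ∸ i) + i) x∈
  ... | z , z∈ , refl with ∈-ivl⁻ z∈
  ... | j , j<m , z≡ , r≡ = j , j<m , cong₂ (λ r z → part v r + z) r≡ z≡

  -- The corner condition is phrased through beads: the bead at i needs an empty place at `suc i` to
  -- move to. This speaks of the values of ϖ_μ and can be compared with descents; `addable-corner`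
  -- and `addable-above` translate it to row lengths.
  record Addable {m} (la mu : Vec ℕ m) (i k : ℕ) : Set where
    constructor addable
    field
      row<  : k < m
      bead≡ : bead mu k ≡ i
      free  : suc i ∉ grassFirst m mu
      fits  : part mu (suc k) < part la (suc k)

  addable? : ∀ {m} (la mu : Vec ℕ m) i → Dec (∃ (Addable la mu i))
  addable? {m} la mu i with anyUpTo? (λ k → bead mu k ≟ i ×-dec ¬? (suc i ∈? grassFirst m mu)
                                       ×-dec part mu (suc k) <? part la (suc k)) m
  ... | yes (k , k<m , b , f , h) = yes (k , addable k<m b f h)
  ... | no ¬a = no λ { (k , addable k<m b f h) → ¬a (k , k<m , b , f , h) }

  module _ {m} {la : Vec ℕ m} (mu : Vec ℕ m) (pmu : IsPartition mu) where

    -- A bead of a higher row exceeds `bead mu k` by at least one for the shift of rows and at least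
    -- one more for the strict drop in length, so it lies beyond `suc (bead mu k)`. Beads of lower
    -- rows lie to the left.
    addable-corner : ∀ {k} → k < m → part mu (suc k) < part la (suc k) →
      (∀ j → k ≡ suc j → part mu (suc k) < part mu (suc j)) → Addable la mu (bead mu k) k
    addable-corner {k} k<m h corner = addable k<m refl (λ s∈ → go (∈-grassFirst⁻ mu s∈)) h
      where
      go : ¬ (∃[ j ] j < m × suc (bead mu k) ≡ bead mu j)
      go (j , j<m , e) with <-cmp j k
      ... | tri≈ _ refl _ = 1+n≢n e
      ... | tri> _ _ k<j = <-asym (bead-antitone mu pmu k<j j<m) (≤-reflexive e)
      go (j , j<m , e) | tri< (s≤s {n = k′} j≤k′) _ _ =
        <⇒≢ (≤-trans (s≤s (+-mono-<-≤ (corner k′ refl) ≤-refl))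
               (≤-trans (≤-reflexive (sym (+-suc _ _)))
                 (+-mono-≤ (part-antitone mu pmu j≤k′)
                   (≤-trans (≤-reflexive (sym (+-∸-assoc 1 (≤-trans (n≤1+n _) k<m)))) (∸-monoʳ-≤ m j≤k′)))))
            e

    -- If the row above had the same length, its bead would occupy exactly the place `suc i` that
    -- has to be free.
    addable-above : ∀ {i k} → Addable la mu i k → ∀ j → k ≡ suc j → part mu (suc k) < part mu (suc j)
    addable-above {k = suc j} (addable k<m refl free h) j refl = ≤∧≢⇒< (pmu j) λ e →
      free (subst (_∈ grassFirst m mu)
             (trans (cong₂ _+_ (sym e) (+-∸-assoc 1 (<⇒≤ k<m))) (+-suc _ _))
             (∈-grassFirst⁺ mu (<⇒≤ k<m)))

    addable-unique : ∀ {i k k′} → Addable la mu i k → Addable la mu i k′ → k ≡ k′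
    addable-unique (addable k<m refl _ _) (addable k′<m e _ _) = bead-injective mu pmu k<m k′<m (sym e)

    increment-partition : ∀ {i k} → Addable la mu i k → IsPartition (increment k mu)
    increment-partition {k = k} a j with suc j ≟ k
    ... | yes refl = subst₂ _≤_ (sym (part-increment k mu (Addable.row< a)))
                       (sym (part-increment-≢ k j mu (<⇒≢ ≤-refl))) (addable-above a j refl)
    ... | no ne with j ≟ k
    ... | yes refl = subst₂ _≤_ (sym (part-increment-≢ k (suc j) mu ne))
                       (sym (part-increment k mu (Addable.row< a))) (m≤n⇒m≤1+n (pmu j))
    ... | no ne′ = subst₂ _≤_ (sym (part-increment-≢ k (suc j) mu ne)) (sym (part-increment-≢ k j mu ne′)) (pmu j)

  increment-contains : ∀ {m} {la mu : Vec ℕ m} {i k} → Contains la mu → Addable la mu i k →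
    Contains la (increment k mu)
  increment-contains {m} {la} {mu} {k = k} c a zero    = z≤n
  increment-contains {m} {la} {mu} {k = k} c a (suc j) with j ≟ k
  ... | yes refl = ≤-trans (≤-reflexive (part-increment k mu (Addable.row< a))) (Addable.fits a)
  ... | no ne    = ≤-trans (≤-reflexive (part-increment-≢ k j mu ne)) (c (suc j))

  -- Skew permutations and their descents

  ∈-map-transp⁻ : ∀ i {x F} → transp i x ∈ map (transp i) F → x ∈ F
  ∈-map-transp⁻ i sx∈ with ∈-map⁻ (transp i) sx∈
  ... | z , z∈ , e = subst (_∈ _) (sym (transp-injective i e)) z∈

  ∉? : ∀ (F : List ℕ) x → Dec (x ∉ F)
  ∉? F x = ¬? (x ∈? F)

  complement : List ℕ → List ℕ → List ℕ
  complement F = filter (∉? F)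

  complement-map-transp : ∀ i F xs →
    complement (map (transp i) F) (map (transp i) xs) ≡ map (transp i) (complement F xs)
  complement-map-transp i F []       = refl
  complement-map-transp i F (x ∷ xs) with transp i x ∈? map (transp i) F | x ∈? F
  ... | yes _   | yes _  = complement-map-transp i F xs
  ... | no _    | no _   = cong (transp i x ∷_) (complement-map-transp i F xs)
  ... | yes sx∈ | no x∉  = ⊥-elim (x∉ (∈-map-transp⁻ i sx∈))
  ... | no sx∉  | yes x∈ = ⊥-elim (sx∉ (∈-map⁺ (transp i) x∈))

  -- Exactly one of i, `suc i` survives the filter, before and after the bead moves. The two
  -- neighbours that s_i would put out of order never both occur, so the relabelled list of nonbeads
  -- is still increasing.
  complement-range : ∀ {i} F {n} → 0 < i → i < n → i ∈ F → suc i ∉ F →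
    complement (map (transp i) F) (range 1 n) ≡ map (transp i) (complement F (range 1 n))
  complement-range {suc p} F {n} _ lt i∈ si∉ with range-split p lt
  ... | q , e rewrite e = begin
      C′ (A ++ (i ∷ suc i ∷ []) ++ B)
        ≡⟨ trans (filter-++ _ A _) (cong (C′ A ++_) (filter-++ _ (i ∷ suc i ∷ []) B)) ⟩
      C′ A ++ C′ (i ∷ suc i ∷ []) ++ C′ B
        ≡⟨ cong₂ _++_ (move A A≡) (cong₂ _++_ middle (move B B≡)) ⟩
      map s (C A) ++ map s (C (i ∷ suc i ∷ [])) ++ map s (C B)
        ≡⟨ trans (map-++ s (C A) _) (cong (map s (C A) ++_) (map-++ s (C (i ∷ suc i ∷ [])) (C B))) ⟨
      map s (C A ++ C (i ∷ suc i ∷ []) ++ C B)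
        ≡⟨ cong (map s) (trans (filter-++ _ A _) (cong (C A ++_) (filter-++ _ (i ∷ suc i ∷ []) B))) ⟨
      map s (C (A ++ (i ∷ suc i ∷ []) ++ B)) ∎
    where
    open ≡-Reasoning
    i = suc p
    s = transp i
    A = range 1 p
    B = range (3 + p) q
    C = complement F
    C′ = complement (map s F)
    A≡ : map s A ≡ A
    A≡ = map-id-local (All.map (λ { (_ , x<) → transp-other (<⇒≢ x<) (<⇒≢ (m<n⇒m<1+n x<)) }) (All-range 1 p))
    B≡ : map s B ≡ B
    B≡ = map-id-local (All.map (λ { (<x , _) → transp-other (>⇒≢ (≤-trans (n≤1+n _) <x)) (>⇒≢ <x) })
           (All-range (3 + p) q))
    move : ∀ X → map s X ≡ X → C′ X ≡ map s (C X)
    move X eq = trans (cong C′ (sym eq)) (complement-map-transp i F X)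
    middle : C′ (i ∷ suc i ∷ []) ≡ map s (C (i ∷ suc i ∷ []))
    middle = begin
      C′ (i ∷ suc i ∷ [])
        ≡⟨ filter-accept (∉? (map s F)) {i} {suc i ∷ []} (λ i∈′ → si∉ (∈-map-transp⁻ i (subst (_∈ map s F) (sym (transp-suc i)) i∈′))) ⟩
      i ∷ C′ (suc i ∷ [])
        ≡⟨ cong (i ∷_) (filter-reject (∉? (map s F)) {suc i} {[]} (λ ¬∈ → ¬∈ (subst (_∈ map s F) (transp-i i) (∈-map⁺ s i∈)))) ⟩
      i ∷ []
        ≡⟨ cong (_∷ []) (transp-suc i) ⟨
      map s (suc i ∷ [])
        ≡⟨ cong (map s) (filter-accept (∉? F) {suc i} {[]} si∉) ⟨
      map s (C (suc i ∷ []))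
        ≡⟨ cong (map s) (filter-reject (∉? F) {i} {suc i ∷ []} (λ ¬∈ → ¬∈ i∈)) ⟨
      map s (C (i ∷ suc i ∷ [])) ∎

  posOf-here : ∀ {x a} w → x ≡ a → posOf x (a ∷ w) ≡ 1
  posOf-here {x} {a} _ e rewrite dec-true (x ≟ a) e = refl

  posOf-there : ∀ {x a} w → x ≢ a → posOf x (a ∷ w) ≡ suc (posOf x w)
  posOf-there {x} {a} _ ne rewrite dec-false (x ≟ a) ne = refl

  posOf-map-transp : ∀ i x w → posOf x (map (transp i) w) ≡ posOf (transp i x) w
  posOf-map-transp i x []      = refl
  posOf-map-transp i x (a ∷ w) with transp i x ≟ a
  ... | yes e = trans (posOf-here {x} {transp i a} (map (transp i) w) (trans (sym (transp-involutive i x)) (cong (transp i) e))) (sym (posOf-here w e))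
  ... | no ne = trans (posOf-there {x} {transp i a} (map (transp i) w) (λ e → ne (trans (cong (transp i) e) (transp-involutive i a))))
                  (trans (cong suc (posOf-map-transp i x w)) (sym (posOf-there w ne)))

  val-posOf : ∀ {x w} → x ∈ w → ∃[ r ] posOf x w ≡ suc r × lookupD 0 w r ≡ x
  val-posOf {x} {a ∷ w} x∈ with x ≟ a
  val-posOf {x} {a ∷ w} _          | yes e = 0 , posOf-here w e , sym e
  val-posOf {x} {a ∷ w} (here e)   | no ne = ⊥-elim (ne e)
  val-posOf {x} {a ∷ w} (there x∈) | no ne with val-posOf x∈
  ... | r , eq , h = suc r , trans (posOf-there w ne) (cong suc eq) , h

  -- Data for an induction on the boxes of λ/μ: at λ the skew permutation is the identity on 1, ...,
  -- n, and each box changes it by one transposition. The values do not depend on the chain, so any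
  -- single one serves.
  data Chain {m} (la : Vec ℕ m) : Vec ℕ m → Set where
    done : Chain la la
    step : ∀ {mu i k} → Addable la mu i k → Chain la (increment k mu) → Chain la mu

  first-difference : ∀ {m} (la mu : Vec ℕ m) → Contains la mu → ∀ b →
    (∀ j → j < b → part mu (suc j) ≡ part la (suc j)) ⊎
    ∃[ k ] k < b × part mu (suc k) < part la (suc k) × (∀ j → j < k → part mu (suc j) ≡ part la (suc j))
  first-difference la mu c zero    = inj₁ λ j ()
  first-difference la mu c (suc b) with first-difference la mu c b
  ... | inj₂ (k , k<b , h , eq) = inj₂ (k , m<n⇒m<1+n k<b , h , eq)
  ... | inj₁ eq with m≤n⇒m<n∨m≡n (c (suc b))
  ... | inj₁ lt = inj₂ (b , ≤-refl , lt , eq)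
  ... | inj₂ e  = inj₁ λ j j<1+b → case-≤ (m≤n⇒m<n∨m≡n j<1+b)
    where
    case-≤ : ∀ {j} → suc j < suc b ⊎ suc j ≡ suc b → part mu (suc j) ≡ part la (suc j)
    case-≤ (inj₁ (s≤s h)) = eq _ h
    case-≤ (inj₂ refl)    = e

  module _ {m} {la : Vec ℕ m} (pla : IsPartition la) where

    -- The topmost row in which μ falls short of λ has a corner: the row above already agrees with
    -- λ, hence is at least as long as the λ-row that μ has not yet filled.
    equal-or-addable : ∀ mu → IsPartition mu → Contains la mu → mu ≡ la ⊎ ∃[ i ] ∃[ k ] Addable la mu i k
    equal-or-addable mu pmu c with first-difference la mu c m
    ... | inj₁ eq = inj₁ (part-extensional mu la eq)
    ... | inj₂ (k , k<m , h , eq) = inj₂ (bead mu k , k , addable-corner mu pmu k<m h λ { j refl →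
            ≤-trans h (≤-trans (pla j) (≤-reflexive (sym (eq j ≤-refl)))) })

    private
      -- The number `d` bounds the boxes still missing and makes the recursion structural. At `d` =
      -- 0 an addable box would give a partition inside λ with more boxes than λ.
      chain-by : ∀ d mu → IsPartition mu → Contains la mu → Vec.sum la ≤ Vec.sum mu + d → Chain la mu
      chain-by d mu pmu c le with equal-or-addable mu pmu c
      ... | inj₁ refl = done
      chain-by zero mu pmu c le | inj₂ (i , k , a) = ⊥-elim (<⇒≱ ≤-refl
        (≤-trans (≤-reflexive (sym (sum-increment k mu (Addable.row< a))))
          (≤-trans (sum-mono (increment k mu) la (increment-contains c a ∘ suc)) (≤-trans le (≤-reflexive (+-identityʳ _))))))
      chain-by (suc d) mu pmu c le | inj₂ (i , k , a) = step a
        (chain-by d (increment k mu) (increment-partition mu pmu a) (increment-contains c a)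
          (≤-trans le (≤-reflexive (trans (+-suc _ d) (cong (_+ d) (sym (sum-increment k mu (Addable.row< a))))))))

    chain : ∀ mu → IsPartition mu → Contains la mu → Chain la mu
    chain mu pmu c = chain-by (Vec.sum la) mu pmu c (m≤n+m _ _)

  module _ {m} {la : Vec ℕ m} (mu : Vec ℕ m) (pmu : IsPartition mu) {i k} (a : Addable la mu i k) where
    open Addable a

    content∈ : i ∈ grassFirst m mu
    content∈ = subst (_∈ grassFirst m mu) bead≡ (∈-grassFirst⁺ mu row<)

    bead-increment : ∀ {j} → j < m → bead (increment k mu) j ≡ transp i (bead mu j)
    bead-increment {j} j<m with j ≟ k
    ... | yes refl = trans (cong (_+ (m ∸ k)) (part-increment k mu row<))
                       (trans (cong suc bead≡) (trans (sym (transp-i i)) (cong (transp i) (sym bead≡))))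
    ... | no ne = trans (cong (_+ (m ∸ j)) (part-increment-≢ k j mu ne))
                    (sym (transp-other (λ e → ne (bead-injective mu pmu j<m row< (trans e (sym bead≡))))
                      (λ e → free (subst (_∈ grassFirst m mu) e (∈-grassFirst⁺ mu j<m)))))

    grassFirst-increment : grassFirst m (increment k mu) ≡ map (transp i) (grassFirst m mu)
    grassFirst-increment = trans (map-cong-local (All.tabulate λ x∈ → pointwise (∈-ivl⁻ x∈))) (map-∘ (ivl 1 m))
      where
      pointwise : ∀ {x} → ∃[ j ] j < m × x ≡ m ∸ j × suc m ∸ x ≡ suc j →
        part (increment k mu) (suc m ∸ x) + x ≡ transp i (part mu (suc m ∸ x) + x)
      pointwise (j , j<m , x≡ , r≡) rewrite r≡ | x≡ = bead-increment j<m

    content-pos : 0 < i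
    content-pos = subst (0 <_) bead≡ (bead-pos mu row<)

    -- Applying s_i to values is left multiplication of ϖ_μ. It therefore reaches ϖ_λ ϖ_μ⁻¹ as right
    -- multiplication, which is the side on which generators are peeled.
    grass-increment : ∀ {n} → i < n → grass m n (increment k mu) ≡ map (transp i) (grass m n mu)
    grass-increment {n} i<n = trans (cong₂ _++_ grassFirst-increment second)
                                (sym (map-++ (transp i) (grassFirst m mu) _))
      where
      second : complement (grassFirst m (increment k mu)) (ivl 1 n)
               ≡ map (transp i) (complement (grassFirst m mu) (ivl 1 n))
      second rewrite grassFirst-increment | ivl≡range 1 n =
        complement-range (grassFirst m mu) content-pos i<n content∈ free

  -- The only value that s_i raises is i. This is why nonbeads never rise while boxes are added.
  transp-≤ : ∀ {i x} → 0 < i → 0 < x → x ≢ i → 0 < transp i x × transp i x ≤ x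
  transp-≤ {i} {x} 0<i 0<x x≢i with x ≟ i | x ≟ suc i
  ... | yes e | _        = ⊥-elim (x≢i e)
  ... | no _  | yes refl = 0<i , n≤1+n i
  ... | no _  | no _     = 0<x , ≤-refl

  module SkewValues {m} (n : ℕ) (la : Vec ℕ m) (pla : IsPartition la) (bound : part la 1 + m ≤ n) where

    skewVal : Vec ℕ m → ℕ → ℕ
    skewVal mu x = val (grass m n la) (posOf x (grass m n mu))

    skewPerm-map : ∀ mu → skewPerm m n la mu ≡ map (skewVal mu) (range 1 n)
    skewPerm-map mu = trans (sym (map-∘ (ivl 1 n))) (cong (map (skewVal mu)) (ivl≡range 1 n))

    private
      F : Vec ℕ m → List ℕ
      F = grassFirst m

    bead≤n : ∀ {k} → bead la k ≤ n
    bead≤n {k} = ≤-trans (+-mono-≤ (part-antitone la pla z≤n) (m∸n≤m m k)) bound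

    content<n : ∀ {mu i k} → Addable la mu i k → i < n
    content<n {mu} {i} {k} (addable _ b _ h) = ≤-trans (subst (_≤ bead la k) (cong suc b) (+-monoˡ-≤ (m ∸ k) h)) bead≤n

    ∈-grass : ∀ {x} → 0 < x → x ≤ n → x ∈ grass m n la
    ∈-grass {x} 0<x x≤n with x ∈? F la
    ... | yes x∈ = ∈-++⁺ˡ x∈
    ... | no x∉  = ∈-++⁺ʳ (F la) (∈-filter⁺ (∉? (F la)) (from ∈-ivl⇔ (0<x , x≤n)) x∉)

    skewVal-self : ∀ {x} → 0 < x → x ≤ n → skewVal la x ≡ x
    skewVal-self 0<x x≤n with val-posOf (∈-grass 0<x x≤n)
    ... | r , p≡ , h = trans (cong (val (grass m n la)) p≡) h

    skewVal-increment : ∀ {mu i k} → IsPartition mu → Addable la mu i k →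
      ∀ x → skewVal mu x ≡ skewVal (increment k mu) (transp i x)
    skewVal-increment {mu} {i} {k} pmu a x = cong (val (grass m n la)) (begin
      posOf x g                              ≡⟨ cong (λ z → posOf z g) (transp-involutive i x) ⟨
      posOf (transp i (transp i x)) g        ≡⟨ posOf-map-transp i (transp i x) g ⟨
      posOf (transp i x) (map (transp i) g)  ≡⟨ cong (posOf (transp i x)) (grass-increment mu pmu a (content<n a)) ⟨
      posOf (transp i x) (grass m n (increment k mu)) ∎)
      where
      open ≡-Reasoning
      g = grass m n mu

    skewPerm-increment : ∀ {mu i k} → IsPartition mu → Addable la mu i k →
      rmulS (skewPerm m n la mu) i ≡ skewPerm m n la (increment k mu)
    -- `rmulS` swaps at list position `i ∸ 1`; positivity of i exposes it as `suc p`.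
    skewPerm-increment {mu} {i} {k} pmu a with content-pos mu pmu a
    skewPerm-increment {mu} {suc p} {k} pmu a | s≤s z≤n = begin
      swapAt (skewPerm m n la mu) p            ≡⟨ cong (λ w → swapAt w p) (skewPerm-map mu) ⟩
      swapAt (map (skewVal mu) (range 1 n)) p  ≡⟨ swapAt-map-range (skewVal mu) p (content<n a) ⟩
      map (skewVal mu ∘ transp (suc p)) (range 1 n)
        ≡⟨ map-cong (λ x → trans (skewVal-increment pmu a (transp (suc p) x))
             (cong (skewVal (increment k mu)) (transp-involutive (suc p) x))) (range 1 n) ⟩
      map (skewVal (increment k mu)) (range 1 n) ≡⟨ skewPerm-map (increment k mu) ⟨
      skewPerm m n la (increment k mu) ∎
      where open ≡-Reasoning

    module _ {mu i k} (pmu : IsPartition mu) (a : Addable la mu i k) where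

      nonbead-≢ : ∀ {x} → x ∉ F mu → x ≢ i
      nonbead-≢ x∉ refl = x∉ (content∈ mu pmu a)

      nonbead-increment : ∀ {x} → x ∉ F mu → transp i x ∉ F (increment k mu)
      nonbead-increment x∉ sx∈ = x∉ (∈-map-transp⁻ i (subst (_ ∈_) (grassFirst-increment mu pmu a) sx∈))

    -- The next four lemmas follow the values while boxes are added to μ one at a time until λ is reached.
    skewVal-bead : ∀ {mu} → Chain la mu → IsPartition mu → ∀ {j} → j < m → skewVal mu (bead mu j) ≡ bead la j
    skewVal-bead done pmu j<m = skewVal-self (bead-pos la j<m) bead≤n
    skewVal-bead {mu} (step a ch) pmu {j} j<m =
      trans (skewVal-increment pmu a (bead mu j))
        (trans (cong (skewVal _) (sym (bead-increment mu pmu a j<m)))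
          (skewVal-bead ch (increment-partition mu pmu a) j<m))

    skewVal-nonbead : ∀ {mu} → Chain la mu → IsPartition mu → ∀ {x} → 0 < x → x ≤ n → x ∉ F mu →
      skewVal mu x ≤ x × skewVal mu x ∉ F la
    skewVal-nonbead done pmu 0<x x≤n x∉ =
      ≤-reflexive (skewVal-self 0<x x≤n) , x∉ ∘ subst (_∈ F la) (skewVal-self 0<x x≤n)
    skewVal-nonbead {mu} (step a ch) pmu {x} 0<x x≤n x∉
      with transp-≤ (content-pos mu pmu a) 0<x (nonbead-≢ pmu a x∉)
    ... | 0<sx , sx≤x with skewVal-nonbead ch (increment-partition mu pmu a) 0<sx (≤-trans sx≤x x≤n)
                             (nonbead-increment pmu a x∉)
    ... | v≤ , v∉ rewrite skewVal-increment pmu a x = ≤-trans v≤ sx≤x , v∉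

    skewVal-nonbead-mono : ∀ {mu} → Chain la mu → IsPartition mu → ∀ {x z} → 0 < x → x < z → z ≤ n →
      x ∉ F mu → z ∉ F mu → skewVal mu x < skewVal mu z
    skewVal-nonbead-mono done pmu 0<x x<z h x∉ z∉ = subst₂ _<_
      (sym (skewVal-self 0<x (≤-trans (<⇒≤ x<z) h))) (sym (skewVal-self (<-trans 0<x x<z) h)) x<z
    skewVal-nonbead-mono {mu} (step a ch) pmu {x} {z} 0<x x<z h x∉ z∉
      with transp-≤ (content-pos mu pmu a) 0<x (nonbead-≢ pmu a x∉)
         | transp-≤ (content-pos mu pmu a) (<-trans 0<x x<z) (nonbead-≢ pmu a z∉)
    ... | 0<sx , _ | _ , sz≤z = subst₂ _<_ (sym (skewVal-increment pmu a x)) (sym (skewVal-increment pmu a z))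
      (skewVal-nonbead-mono ch (increment-partition mu pmu a) 0<sx
        (transp-<-mono (nonbead-≢ pmu a x∉) (nonbead-≢ pmu a z∉) x<z) (≤-trans sz≤z h)
        (nonbead-increment pmu a x∉) (nonbead-increment pmu a z∉))

    skewVal-fixed : ∀ {mu} → Chain la mu → IsPartition mu → ∀ {j} → j < m →
      part mu (suc j) ≡ part la (suc j) → suc (bead mu j) ∉ F mu → suc (bead mu j) ≤ n →
      skewVal mu (suc (bead mu j)) ≡ suc (bead mu j)
    skewVal-fixed done pmu j<m e x∉ x≤n = skewVal-self (s≤s z≤n) x≤n
    skewVal-fixed {mu} (step {i = i} {k = k} a ch) pmu {j} j<m e x∉ x≤n = begin
      skewVal mu x                            ≡⟨ skewVal-increment pmu a x ⟩
      skewVal (increment k mu) (transp i x)   ≡⟨ cong (skewVal (increment k mu)) (trans sx≡x (cong suc (sym b≡))) ⟩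
      skewVal (increment k mu) (suc (bead (increment k mu) j))
        ≡⟨ skewVal-fixed ch (increment-partition mu pmu a) j<m (trans p≡ e)
             (λ x∈ → nonbead-increment pmu a x∉ (subst (_∈ F (increment k mu)) (trans (cong suc b≡) (sym sx≡x)) x∈))
             (subst (_≤ n) (cong suc (sym b≡)) x≤n) ⟩
      suc (bead (increment k mu) j)           ≡⟨ cong suc b≡ ⟩
      x ∎
      where
      open ≡-Reasoning
      x = suc (bead mu j)
      j≢k : j ≢ k
      j≢k refl = <⇒≢ (Addable.fits a) e
      p≡ : part (increment k mu) (suc j) ≡ part mu (suc j)
      p≡ = part-increment-≢ k j mu j≢k
      b≡ : bead (increment k mu) j ≡ bead mu j
      b≡ = cong (_+ (m ∸ j)) p≡
      -- s_i could move x only as i, excluded because i is a bead and x is not, or as `suc i`, in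
      -- which case the growing row would be row j, which is already full.
      sx≡x : transp i x ≡ x
      sx≡x = transp-other (nonbead-≢ pmu a x∉)
        (λ e′ → j≢k (bead-injective mu pmu j<m (Addable.row< a) (trans (suc-injective e′) (sym (Addable.bead≡ a)))))

    module _ {mu} (pmu : IsPartition mu) (c : Contains la mu) where
      private
        ch : Chain la mu
        ch = chain pla mu pmu c

      -- The bead at i ends at `bead la k`, which is at least `suc i` because the new box fits into
      -- λ. The nonbead `suc i` does not rise and does not end on a bead of λ, so it ends strictly
      -- below.
      addable⇒descent : ∀ {i k} → Addable la mu i k → skewVal mu (suc i) < skewVal mu i
      addable⇒descent {i} {k} a@(addable k<m b f h) =
        let v≤ , v∉ = skewVal-nonbead ch pmu (s≤s z≤n) (content<n a) f in
        subst (skewVal mu (suc i) <_) (sym vi≡)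
          (≤∧≢⇒< (≤-trans v≤ (subst (_≤ bead la k) (cong suc b) (+-monoˡ-≤ (m ∸ k) h)))
            (λ e → v∉ (subst (_∈ F la) (sym e) (∈-grassFirst⁺ la k<m))))
        where
        vi≡ : skewVal mu i ≡ bead la k
        vi≡ = trans (cong (skewVal mu) (sym b)) (skewVal-bead ch pmu k<m)

      -- Two nonbeads keep their order, and so do two beads; a nonbead followed by a bead cannot
      -- cross, as one falls and the other rises. There remains a bead at i with `suc i` free. If
      -- its row were full, both values would be fixed, which is again an ascent.
      descent⇒addable : ∀ {i} → 0 < i → i < n → skewVal mu (suc i) < skewVal mu i → ∃ (Addable la mu i)
      descent⇒addable {i} 0<i i<n d with i ∈? F mu | suc i ∈? F mu
      ... | no i∉ | no si∉ = ⊥-elim (<-asym d (skewVal-nonbead-mono ch pmu 0<i ≤-refl i<n i∉ si∉))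
      ... | no i∉ | yes si∈ with ∈-grassFirst⁻ mu si∈
      ...   | k , k<m , e = ⊥-elim (<-asym d (≤-trans (s≤s (proj₁ (skewVal-nonbead ch pmu 0<i (<⇒≤ i<n) i∉)))
                (≤-trans (≤-reflexive e) (≤-trans (+-monoˡ-≤ (m ∸ k) (c (suc k)))
                  (≤-reflexive (sym (trans (cong (skewVal mu) e) (skewVal-bead ch pmu k<m))))))))
      descent⇒addable {i} 0<i i<n d | yes i∈ | yes si∈ with ∈-grassFirst⁻ mu i∈ | ∈-grassFirst⁻ mu si∈
      ... | k , k<m , e | k′ , k′<m , e′ = ⊥-elim (<-asym d (subst₂ _<_
              (sym (trans (cong (skewVal mu) e) (skewVal-bead ch pmu k<m)))
              (sym (trans (cong (skewVal mu) e′) (skewVal-bead ch pmu k′<m)))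
              (bead-antitone la pla k′<k k<m)))
        where
        k′<k : k′ < k
        k′<k with <-cmp k′ k
        ... | tri< h _ _    = h
        ... | tri≈ _ refl _ = ⊥-elim (1+n≢n (trans e′ (sym e)))
        ... | tri> _ _ h    = ⊥-elim (<-asym (bead-antitone mu pmu h k′<m) (subst₂ _<_ e e′ ≤-refl))
      descent⇒addable {i} 0<i i<n d | yes i∈ | no si∉ with ∈-grassFirst⁻ mu i∈
      ... | k , k<m , refl with m≤n⇒m<n∨m≡n (c (suc k))
      ...   | inj₁ h = k , addable k<m refl si∉ h
      ...   | inj₂ e = ⊥-elim (<-asym d (subst₂ _<_
                (sym (trans (skewVal-bead ch pmu k<m) (cong (_+ (m ∸ k)) (sym e))))
                (sym (skewVal-fixed ch pmu k<m e si∉ i<n)) ≤-refl))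

    val-skewPerm : ∀ mu {x} → 0 < x → x ≤ n → val (skewPerm m n la mu) x ≡ skewVal mu x
    val-skewPerm mu {suc p} _ x≤n = trans (cong (λ w → val w (suc p)) (skewPerm-map mu))
      (trans (lookupD-map-range 0 (skewVal mu) 1 n p x≤n) (cong (skewVal mu) (+-comm p 1)))

    length-skewPerm : ∀ mu → length (skewPerm m n la mu) ≡ n
    length-skewPerm mu = trans (cong length (skewPerm-map mu))
      (trans (length-map (skewVal mu) (range 1 n)) (length-iterate suc 1 n))

    skewPerm-self : idPerm n ≡ skewPerm m n la la
    skewPerm-self = trans (ivl≡range 1 n) (sym (trans (skewPerm-map la)
      (map-id-local (All.map (λ { (p , q) → skewVal-self p (≤-pred q) }) (All-range 1 n)))))

    -- This makes the empty product contribute 0 unless μ = λ: otherwise some box is addable, and it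
    -- gives a descent, which the identity does not have.
    skewPerm-≢ : ∀ mu → IsPartition mu → Contains la mu → mu ≢ la → idPerm n ≢ skewPerm m n la mu
    skewPerm-≢ mu pmu c ne e with equal-or-addable pla mu pmu c
    ... | inj₁ mu≡la       = ne mu≡la
    ... | inj₂ (i , k , a) = <-asym ≤-refl (subst₂ _<_ (fixed (s≤s z≤n) i<n)
            (fixed (content-pos mu pmu a) (≤-trans (n≤1+n i) i<n)) (addable⇒descent pmu c a))
      where
      i<n = content<n a
      fixed : ∀ {x} → 0 < x → x ≤ n → skewVal mu x ≡ x
      fixed {suc p} 0<x x≤n = trans (sym (val-skewPerm mu 0<x x≤n)) (trans (cong (λ w → val w (suc p)) (sym e))
        (trans (cong (λ w → val w (suc p)) (trans (ivl≡range 1 n) (sym (map-id (range 1 n)))))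
          (trans (lookupD-map-range 0 id 1 n p x≤n) (+-comm p 1))))

  -- Fillings as increasing sequences of factors

  -- A key (L , d) stands for the factor of the product of weight L and index d,
  -- and for a box of content index d with entry L.
  Key : Set
  Key = Letter × ℕ

  -- The order of the factors, read from right to left.
  data _≺_ : Key → Key → Set where
    m≺m : ∀ {a b d e} → b < a → (marked a , d) ≺ (marked b , e)
    m≡m : ∀ {a d e} → d < e → (marked a , d) ≺ (marked a , e)
    m≺u : ∀ {a b d e} → (marked a , d) ≺ (unmarked b , e)
    u≺u : ∀ {a b d e} → a < b → (unmarked a , d) ≺ (unmarked b , e)
    u≡u : ∀ {a d e} → e < d → (unmarked a , d) ≺ (unmarked a , e)

  ≺-asym : ∀ {f g} → f ≺ g → ¬ (g ≺ f)
  ≺-asym (m≺m h) (m≺m h′) = <-asym h h′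
  ≺-asym (m≺m h) (m≡m _)  = <-irrefl refl h
  ≺-asym (m≡m _) (m≺m h)  = <-irrefl refl h
  ≺-asym (m≡m h) (m≡m h′) = <-asym h h′
  ≺-asym (u≺u h) (u≺u h′) = <-asym h h′
  ≺-asym (u≺u h) (u≡u _)  = <-irrefl refl h
  ≺-asym (u≡u _) (u≺u h)  = <-irrefl refl h
  ≺-asym (u≡u h) (u≡u h′) = <-asym h h′

  ≺-irrefl : ∀ {f} → ¬ (f ≺ f)
  ≺-irrefl h = ≺-asym h h

  Sorted : List Key → Set
  Sorted = AllPairs _≺_

  -- The box that enlarges μ is the leftmost box of its row in λ/μ, so its entry goes to the front
  -- of that row.
  consAt : ∀ {A : Set} → ℕ → A → List (List A) → List (List A)
  consAt k       a []      = []
  consAt zero    a (r ∷ U) = (a ∷ r) ∷ U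
  consAt (suc k) a (r ∷ U) = r ∷ consAt k a U

  module _ {A : Set} where

    consAt-injective : ∀ k (a : A) {U U′} → consAt k a U ≡ consAt k a U′ → U ≡ U′
    consAt-injective k       a {[]}    {[]}     e = refl
    consAt-injective zero    a {[]}    {r ∷ U′} ()
    consAt-injective zero    a {r ∷ U} {[]}     ()
    consAt-injective (suc k) a {[]}    {r ∷ U′} ()
    consAt-injective (suc k) a {r ∷ U} {[]}     ()
    consAt-injective zero    a {r ∷ U} {s ∷ U′} refl = refl
    consAt-injective (suc k) a {r ∷ U} {s ∷ U′} e =
      cong₂ _∷_ (∷-injectiveˡ e) (consAt-injective k a (∷-injectiveʳ e))

    len-consAt : ∀ k (a : A) U → len (consAt k a U) ≡ len U
    len-consAt k       a []      = refl
    len-consAt zero    a (r ∷ U) = refl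
    len-consAt (suc k) a (r ∷ U) = cong suc (len-consAt k a U)

    lookupD-consAt : ∀ k (a : A) U → k < len U → lookupD [] (consAt k a U) k ≡ a ∷ lookupD [] U k
    lookupD-consAt zero    a (r ∷ U) _       = refl
    lookupD-consAt (suc k) a (r ∷ U) (s≤s h) = lookupD-consAt k a U h

    lookupD-consAt-≢ : ∀ k j (a : A) U → j ≢ k → lookupD [] (consAt k a U) j ≡ lookupD [] U j
    lookupD-consAt-≢ k       j       a []      _  = refl
    lookupD-consAt-≢ zero    zero    a (r ∷ U) ne = ⊥-elim (ne refl)
    lookupD-consAt-≢ zero    (suc j) a (r ∷ U) _  = refl
    lookupD-consAt-≢ (suc k) zero    a (r ∷ U) _  = refl
    lookupD-consAt-≢ (suc k) (suc j) a (r ∷ U) ne = lookupD-consAt-≢ k j a U (ne ∘ cong suc)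

    unconsAt : ∀ k (U : List (List A)) → 0 < len (lookupD [] U k) → ∃[ a ] ∃[ U′ ] U ≡ consAt k a U′
    unconsAt zero    ((a ∷ r) ∷ U) _ = a , r ∷ U , refl
    unconsAt (suc k) (r ∷ U)       h with unconsAt k U h
    ... | a , U′ , refl = a , r ∷ U′ , refl

    all-empty : ∀ (U : List (List A)) → (∀ k → k < len U → len (lookupD [] U k) ≡ 0) → U ≡ replicate (len U) []
    all-empty []            _ = refl
    all-empty ([] ∷ U)      h = cong ([] ∷_) (all-empty U λ k k< → h (suc k) (s≤s k<))
    all-empty ((a ∷ r) ∷ U) h with () ← h 0 (s≤s z≤n)

    lookupD-replicate : ∀ m k → lookupD {List A} [] (replicate m []) k ≡ []
    lookupD-replicate zero    k       = refl
    lookupD-replicate (suc m) zero    = refl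
    lookupD-replicate (suc m) (suc k) = lookupD-replicate m k

  module Fillings {m} (la : Vec ℕ m) (pla : IsPartition la) where

    -- The box in row suc k and column j.
    Cell : Vec ℕ m → ℕ → ℕ → Set
    Cell mu k j = k < m × part mu (suc k) < j × j ≤ part la (suc k)

    content : ℕ → ℕ → ℕ
    content k j = m ∸ suc k + j

    key : Vec ℕ m → Filling → ℕ → ℕ → Key
    key mu U k j = entry mu U (suc k) j , content k j

    -- A local form of the bitableau axioms. The single relation `≺` between neighbours encodes weak
    -- and strict conditions at once, since contents increase to the right and decrease downwards.
    -- The alphabet and the flags are absorbed into `key∈`.
    record Valid (fs : List Key) (mu : Vec ℕ m) (U : Filling) : Set where
      field
        rows   : len U ≡ m
        rowLen : ∀ k → k < m → len (lookupD [] U k) ≡ part la (suc k) ∸ part mu (suc k)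
        key∈   : ∀ {k j} → Cell mu k j → key mu U k j ∈ fs
        right  : ∀ {k j} → Cell mu k j → Cell mu k (suc j) → key mu U k j ≺ key mu U k (suc j)
        down   : ∀ {k j} → Cell mu k j → Cell mu (suc k) j → key mu U k j ≺ key mu U (suc k) j

    -- The recursion copies the expansion of the coefficient: each factor is skipped, or spent on
    -- the addable box of its index. The decision is passed to `fillings-with` as an argument so
    -- that proofs can branch on it separately.
    fillings : List Key → Vec ℕ m → List Filling
    fillings-with : ∀ {mu} (f : Key) → List Key → Dec (∃ (Addable la mu (proj₂ f))) → List Filling

    fillings []       mu with Vec.≡-dec ℕ._≟_ mu la
    ... | yes _ = replicate m [] ∷ []
    ... | no _  = []
    fillings (f ∷ fs) mu = fillings fs mu ++ fillings-with {mu} f fs (addable? la mu (proj₂ f))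

    fillings-with f fs (no _) = []
    fillings-with {mu} (L , _) fs (yes (k , _)) = map (consAt k L) (fillings fs (increment k mu))

    content-first : ∀ mu {k} → k < m → content k (suc (part mu (suc k))) ≡ bead mu k
    content-first mu {k} k<m = trans (+-suc _ _)
      (trans (cong (_+ part mu (suc k)) (sym (+-∸-assoc 1 k<m))) (+-comm (m ∸ k) _))

    module _ (mu : Vec ℕ m) (pmu : IsPartition mu) {i k} (a : Addable la mu i k) where
      open Addable a
      private
        mu⁺ = increment k mu
        first = suc (part mu (suc k))

      cell-weaken : ∀ {k′ j} → Cell mu⁺ k′ j → Cell mu k′ j
      cell-weaken {k′} (k′<m , l , u) with k′ ≟ k
      ... | yes refl = k′<m , <-trans ≤-refl (subst (_< _) (part-increment k mu row<) l) , u
      ... | no ne    = k′<m , subst (_< _) (part-increment-≢ k k′ mu ne) l , u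

      cell-cases : ∀ {k′ j} → Cell mu k′ j → (k′ ≡ k × j ≡ first) ⊎ Cell mu⁺ k′ j
      cell-cases {k′} (k′<m , l , u) with k′ ≟ k
      ... | no ne    = inj₂ (k′<m , subst (_< _) (sym (part-increment-≢ k k′ mu ne)) l , u)
      ... | yes refl with m≤n⇒m<n∨m≡n l
      ... | inj₁ l′   = inj₂ (k′<m , subst (_< _) (sym (part-increment k mu row<)) l′ , u)
      ... | inj₂ refl = inj₁ (refl , refl)

      ¬cell-first : ¬ Cell mu⁺ k first
      ¬cell-first (_ , l , _) = <-irrefl (part-increment k mu row<) l

      cell-first : Cell mu k first
      cell-first = row< , ≤-refl , fits

      module _ (L : Letter) (U : Filling) (rows : len U ≡ m) where

        key-first : key mu (consAt k L U) k first ≡ (L , i)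
        key-first rewrite lookupD-consAt k L U (subst (k <_) (sym rows) row<) | n∸n≡0 (part mu (suc k)) =
          cong (L ,_) (trans (content-first mu row<) bead≡)

        key-rest : ∀ {k′ j} → Cell mu⁺ k′ j → key mu (consAt k L U) k′ j ≡ key mu⁺ U k′ j
        key-rest {k′} {j} (_ , l , _) with k′ ≟ k
        ... | no ne rewrite lookupD-consAt-≢ k k′ L U ne | part-increment-≢ k k′ mu ne = refl
        ... | yes refl rewrite lookupD-consAt k L U (subst (k <_) (sym rows) row<) | part-increment k mu row<
                             | +-∸-assoc 1 l = refl

      -- The new key precedes all keys of `fs`, so comparisons with the boxes to its right and below
      -- hold at once. There is no box to its left, and the place above it belongs to μ by
      -- `addable-above`.
      valid-consAt : ∀ {L fs U} → Sorted ((L , i) ∷ fs) → Valid fs mu⁺ U → Valid ((L , i) ∷ fs) mu (consAt k L U)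
      valid-consAt {L} {fs} {U} (f≺ ∷ _) val = record
        { rows   = trans (len-consAt k L U) rows
        ; rowLen = rowLen′
        ; key∈   = key∈′
        ; right  = right′
        ; down   = down′
        }
        where
        open Valid val
        rest : ∀ {k′ j} → Cell mu⁺ k′ j → key mu (consAt k L U) k′ j ≡ key mu⁺ U k′ j
        rest = key-rest L U rows
        rowLen′ : ∀ k′ → k′ < m → len (lookupD [] (consAt k L U) k′) ≡ part la (suc k′) ∸ part mu (suc k′)
        rowLen′ k′ k′<m with k′ ≟ k
        ... | no ne rewrite lookupD-consAt-≢ k k′ L U ne =
                trans (rowLen k′ k′<m) (cong (part la (suc k′) ∸_) (part-increment-≢ k k′ mu ne))
        ... | yes refl rewrite lookupD-consAt k L U (subst (k <_) (sym rows) row<) =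
                trans (cong suc (trans (rowLen k′ k′<m) (cong (part la (suc k′) ∸_) (part-increment k mu row<))))
                  (sym (+-∸-assoc 1 fits))
        first≺ : ∀ {k′ j} → Cell mu⁺ k′ j → (L , i) ≺ key mu (consAt k L U) k′ j
        first≺ b = subst ((L , i) ≺_) (sym (rest b)) (All.lookup f≺ (key∈ b))
        key∈′ : ∀ {k′ j} → Cell mu k′ j → key mu (consAt k L U) k′ j ∈ (L , i) ∷ fs
        key∈′ b with cell-cases b
        ... | inj₁ (refl , refl) = here (key-first L U rows)
        ... | inj₂ b⁺            = there (subst (_∈ fs) (sym (rest b⁺)) (key∈ b⁺))
        right′ : ∀ {k′ j} → Cell mu k′ j → Cell mu k′ (suc j) →
          key mu (consAt k L U) k′ j ≺ key mu (consAt k L U) k′ (suc j)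
        right′ b b′ with cell-cases b | cell-cases b′
        ... | inj₁ (refl , refl) | inj₁ (_ , e) = ⊥-elim (1+n≢n e)
        ... | inj₁ (refl , refl) | inj₂ b⁺ = subst₂ _≺_ (sym (key-first L U rows)) refl (first≺ b⁺)
        ... | inj₂ b⁺ | inj₁ (refl , e) = ⊥-elim (<-irrefl (sym (suc-injective e)) (proj₁ (proj₂ (cell-weaken b⁺))))
        ... | inj₂ b⁺ | inj₂ b⁺′ = subst₂ _≺_ (sym (rest b⁺)) (sym (rest b⁺′)) (right b⁺ b⁺′)
        down′ : ∀ {k′ j} → Cell mu k′ j → Cell mu (suc k′) j →
          key mu (consAt k L U) k′ j ≺ key mu (consAt k L U) (suc k′) j
        down′ {k′} b b′ with cell-cases b | cell-cases b′
        ... | inj₁ (refl , _) | inj₁ (e , _) = ⊥-elim (1+n≢n e)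
        ... | inj₁ (refl , refl) | inj₂ b⁺ = subst₂ _≺_ (sym (key-first L U rows)) refl (first≺ b⁺)
        ... | inj₂ b⁺ | inj₁ (refl , refl) =
                ⊥-elim (<⇒≱ (proj₁ (proj₂ (cell-weaken b⁺))) (addable-above mu pmu a k′ refl))
        ... | inj₂ b⁺ | inj₂ b⁺′ = subst₂ _≺_ (sym (rest b⁺)) (sym (rest b⁺′)) (down b⁺ b⁺′)

      -- That the remaining keys avoid the removed one is taken as a hypothesis here; it rests on
      -- the minimality of that key and is supplied in `fillings-complete`.
      valid-unconsAt : ∀ {L fs U} → len U ≡ m → (∀ {k′ j} → Cell mu⁺ k′ j → key mu⁺ U k′ j ∈ fs) →
        Valid ((L , i) ∷ fs) mu (consAt k L U) → Valid fs mu⁺ U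
      valid-unconsAt {L} {fs} {U} rows key∈ val = record
        { rows   = rows
        ; rowLen = rowLen′
        ; key∈   = key∈
        ; right  = λ b b′ → subst₂ _≺_ (rest b) (rest b′) (right (cell-weaken b) (cell-weaken b′))
        ; down   = λ b b′ → subst₂ _≺_ (rest b) (rest b′) (down (cell-weaken b) (cell-weaken b′))
        }
        where
        open Valid val using (rowLen; right; down)
        rest : ∀ {k′ j} → Cell mu⁺ k′ j → key mu (consAt k L U) k′ j ≡ key mu⁺ U k′ j
        rest = key-rest L U rows
        rowLen′ : ∀ k′ → k′ < m → len (lookupD [] U k′) ≡ part la (suc k′) ∸ part mu⁺ (suc k′)
        rowLen′ k′ k′<m with k′ ≟ k
        ... | no ne = trans (cong len (sym (lookupD-consAt-≢ k k′ L U ne)))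
                (trans (rowLen k′ k′<m) (cong (part la (suc k′) ∸_) (sym (part-increment-≢ k k′ mu ne))))
        ... | yes refl = suc-injective (trans (cong len (sym (lookupD-consAt k L U (subst (k <_) (sym rows) row<))))
                (trans (rowLen k′ k′<m) (trans (+-∸-assoc 1 fits)
                  (cong (λ r → suc (part la (suc k′) ∸ r)) (sym (part-increment k mu row<))))))

    valid-weaken : ∀ {f fs mu U} → Valid fs mu U → Valid (f ∷ fs) mu U
    valid-weaken val = record { Valid val ; key∈ = there ∘ Valid.key∈ val }

    -- A cell carrying the minimal key has neither a left nor an upper neighbour.
    minimal-addable : ∀ {f fs mu U} → IsPartition mu → Sorted (f ∷ fs) → Valid (f ∷ fs) mu U →
      ∀ {k j} → Cell mu k j → key mu U k j ≡ f → j ≡ suc (part mu (suc k)) × Addable la mu (proj₂ f) k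
    minimal-addable {f} {fs} {mu} {U} pmu (f≺ ∷ _) val {k} {j} b@(k<m , l , u) e = j≡ , subst (λ i → Addable la mu i k)
      (trans (sym (content-first mu k<m)) (trans (cong (content k) (sym j≡)) (cong proj₂ e)))
      (addable-corner mu pmu k<m (≤-trans l u) above)
      where
      open Valid val
      ¬≺f : ∀ {k j} → Cell mu k j → ¬ (key mu U k j ≺ f)
      ¬≺f b′ h with key∈ b′
      ... | here e′  = ≺-irrefl (subst (_≺ f) e′ h)
      ... | there ∈fs = ≺-asym h (All.lookup f≺ ∈fs)
      leftmost : ∀ j → Cell mu k j → key mu U k j ≡ f → part mu (suc k) < j → j ≡ suc (part mu (suc k))
      leftmost (suc j) b e (s≤s l) with m≤n⇒m<n∨m≡n l
      ... | inj₂ refl = refl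
      ... | inj₁ l′ = let b′ = k<m , l′ , ≤-trans (n≤1+n j) (proj₂ (proj₂ b)) in
              ⊥-elim (¬≺f b′ (subst (_ ≺_) e (right b′ b)))
      j≡ = leftmost j b e l
      above : ∀ k′ → k ≡ suc k′ → part mu (suc k) < part mu (suc k′)
      above k′ refl = ≰⇒> λ h →
        let b′ = <-trans ≤-refl k<m , ≤-<-trans h l , ≤-trans u (pla k′) in
        ¬≺f b′ (subst (_ ≺_) e (down b′ b))

    fillings-sound : ∀ fs mu → Sorted fs → IsPartition mu → ∀ {U} → U ∈ fillings fs mu → Valid fs mu U
    fillings-sound [] mu _ pmu U∈ with Vec.≡-dec ℕ._≟_ mu la
    fillings-sound [] mu _ pmu (here refl) | yes refl = record
      { rows   = length-replicate m
      ; rowLen = λ k _ → trans (cong len (lookupD-replicate m k)) (sym (n∸n≡0 (part la (suc k))))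
      ; key∈   = λ { (_ , l , u) → ⊥-elim (<⇒≱ l u) }
      ; right  = λ { (_ , l , u) → ⊥-elim (<⇒≱ l u) }
      ; down   = λ { (_ , l , u) → ⊥-elim (<⇒≱ l u) }
      }
    fillings-sound (f ∷ fs) mu sorted@(_ ∷ sorted′) pmu {U} U∈ with ∈-++⁻ (fillings fs mu) U∈
    ... | inj₁ U∈′ = valid-weaken (fillings-sound fs mu sorted′ pmu U∈′)
    ... | inj₂ U∈′ with addable? la mu (proj₂ f)
    ... | yes (k , a) with ∈-map⁻ (consAt k (proj₁ f)) U∈′
    ... | U′ , U′∈ , refl = valid-consAt mu pmu a sorted
            (fillings-sound fs (increment k mu) sorted′ (increment-partition mu pmu a) U′∈)

    -- The first key is minimal, so it can only occur at the addable box of its index. Inspecting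
    -- that one box decides whether the factor was skipped or used.
    fillings-complete : ∀ fs mu → Sorted fs → IsPartition mu → Contains la mu → ∀ {U} →
      Valid fs mu U → U ∈ fillings fs mu
    fillings-complete [] mu _ pmu c {U} val with Vec.≡-dec ℕ._≟_ mu la
    ... | yes refl = here (trans
            (all-empty U λ k k< → trans (rowLen k (subst (k <_) rows k<)) (n∸n≡0 (part la (suc k))))
            (cong (λ r → replicate r []) rows))
      where open Valid val
    ... | no ne = ⊥-elim (ne (part-extensional mu la λ j j<m → ≤-antisym (c (suc j)) (≮⇒≥ λ h →
            absurd (Valid.key∈ val {j} {part la (suc j)} (j<m , h , ≤-refl)))))
      where
      absurd : ∀ {f} → ¬ (f ∈ [])
      absurd ()
    fillings-complete ((_ , i) ∷ fs) mu sorted@(f≺ ∷ sorted′) pmu c {U} val with addable? la mu i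
    ... | no ¬a = ∈-++⁺ˡ (fillings-complete fs mu sorted′ pmu c (record { Valid val ; key∈ = key∈′ }))
      where
      key∈′ : ∀ {k j} → Cell mu k j → key mu U k j ∈ fs
      key∈′ b with Valid.key∈ val b
      ... | there ∈fs = ∈fs
      ... | here e    = ⊥-elim (¬a (_ , proj₂ (minimal-addable pmu sorted val b e)))
    ... | yes (k , a) with Valid.key∈ val (cell-first mu pmu a)
    ... | there first∈ = ∈-++⁺ˡ (fillings-complete fs mu sorted′ pmu c (record { Valid val ; key∈ = key∈′ }))
      where
      key∈′ : ∀ {k j} → Cell mu k j → key mu U k j ∈ fs
      key∈′ b with Valid.key∈ val b
      ... | there ∈fs = ∈fs
      ... | here e with minimal-addable pmu sorted val b e
      ... | refl , a′ with addable-unique mu pmu a a′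
      ... | refl = first∈
    ... | here e with unconsAt k U (subst (0 <_) (sym (Valid.rowLen val k (Addable.row< a))) (m<n⇒0<n∸m (Addable.fits a)))
    ... | L , U′ , refl with trans (sym (key-first mu pmu a L U′ rows′)) e
      where
      rows′ : len U′ ≡ m
      rows′ = trans (sym (len-consAt k L U′)) (Valid.rows val)
    ... | refl = ∈-++⁺ʳ (fillings fs mu) (∈-map⁺ (consAt k L)
            (fillings-complete fs (increment k mu) sorted′ (increment-partition mu pmu a) (increment-contains c a)
              (valid-unconsAt mu pmu a rows′ key∈′ val)))
      where
      rows′ : len U′ ≡ m
      rows′ = trans (sym (len-consAt k L U′)) (Valid.rows val)
      key∈′ : ∀ {k′ j} → Cell (increment k mu) k′ j → key (increment k mu) U′ k′ j ∈ fs
      key∈′ b with subst (_∈ (L , i) ∷ fs) (key-rest mu pmu a L U′ rows′ b) (Valid.key∈ val (cell-weaken mu pmu a b))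
      ... | there ∈fs = ∈fs
      -- Another box with the minimal key would also be the addable box of its index, which is the
      -- one just removed. Minimality is applied to the full filling, hence the passage back to
      -- cells of `mu`.
      ... | here e′ with minimal-addable pmu sorted val (cell-weaken mu pmu a b)
                           (trans (key-rest mu pmu a L U′ rows′ b) e′)
      ... | refl , a′ with addable-unique mu pmu a a′
      ... | refl = ⊥-elim (¬cell-first mu pmu a b)

    -- The two branches are separated by the entry of the addable box: a filling in both would have
    -- the key f there and also a key from `fs`, all of which lie strictly after f.
    fillings-unique : ∀ fs mu → Sorted fs → IsPartition mu → Unique (fillings fs mu)
    fillings-unique [] mu _ pmu with Vec.≡-dec ℕ._≟_ mu la
    ... | yes _ = [] ∷ []
    ... | no _  = []
    fillings-unique (f ∷ fs) mu (f≺ ∷ sorted) pmu = Unique.++⁺ (fillings-unique fs mu sorted pmu) second disjoint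
      where
      second : Unique (fillings-with {mu} f fs (addable? la mu (proj₂ f)))
      second with addable? la mu (proj₂ f)
      ... | no _        = []
      ... | yes (k , a) = Unique.map⁺ (consAt-injective k (proj₁ f))
              (fillings-unique fs (increment k mu) sorted (increment-partition mu pmu a))
      disjoint : ∀ {U} → ¬ (U ∈ fillings fs mu × U ∈ fillings-with {mu} f fs (addable? la mu (proj₂ f)))
      disjoint (U∈ , U∈′) with addable? la mu (proj₂ f)
      ... | yes (k , a) with ∈-map⁻ (consAt k (proj₁ f)) U∈′
      ... | U′ , U′∈ , refl = ≺-irrefl (All.lookup f≺ (subst (_∈ fs)
              (key-first mu pmu a (proj₁ f) U′ (Valid.rows (fillings-sound fs (increment k mu) sorted
                (increment-partition mu pmu a) U′∈)))
              (Valid.key∈ (fillings-sound fs mu sorted pmu U∈) (cell-first mu pmu a))))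

  -- The list of factors and its order

  AllPairs-reverse : ∀ {A : Set} {R : A → A → Set} {xs} → AllPairs (flip R) xs → AllPairs R (reverse xs)
  AllPairs-reverse {xs = []}     []          = []
  AllPairs-reverse {R = R} {x ∷ xs} (px ∷ pxs) = subst (AllPairs R) (sym (unfold-reverse x xs))
    (AllPairs.++⁺ (AllPairs-reverse pxs) ([] ∷ []) (All.tabulate λ y∈ → All.lookup px (Any.reverse⁻ y∈) ∷ []))

  AllPairs-concatMap : ∀ {R : Key → Key → Set} {S : ℕ → ℕ → Set} (g : ℕ → ℕ → Key) (xs : ℕ → List ℕ) {ks} →
    (∀ k → AllPairs R (map (g k) (xs k))) → (∀ {k k′} d e → S k k′ → R (g k d) (g k′ e)) →
    AllPairs S ks → AllPairs R (concatMap (λ k → map (g k) (xs k)) ks)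
  AllPairs-concatMap g xs {ks} inner outer pks = AllPairs.concat⁺
    (All.map⁺ (All.universal inner ks))
    (AllPairs.map⁺ (AllPairs.map (λ s → All.map⁺ (All.universal (λ d → All.map⁺ (All.universal (λ e → outer d e s) _)) _)) pks))

  ivl-ascending : ∀ a b → AllPairs _<_ (ivl a b)
  ivl-ascending a b = AllPairs.map⁺ (AllPairs.applyUpTo⁺₁ id (suc b ∸ a) λ i<j _ → +-monoʳ-< a i<j)

  ivl-descending : ∀ a b → AllPairs _>_ (reverse (ivl a b))
  ivl-descending a b = AllPairs-reverse (ivl-ascending a b)

  size : Letter → ℕ
  size (marked k)   = k
  size (unmarked k) = k

  -- The list `factors` with letters in place of weights. Different letters may have equal weights
  -- in the ring, so the order and the labelling of boxes exist only at this level.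
  factorKeys : ℕ → List Key
  factorKeys n =
    concatMap (λ k → map (λ i → (unmarked k , i)) (ivl k (n ∸ 1))) (reverse (ivl 1 (n ∸ 1)))
    ++ concatMap (λ k → map (λ i → (marked k , i)) (reverse (ivl k (n ∸ 1)))) (ivl 1 (n ∸ 1))

  -- Reversed because `product` multiplies on the right, so the last factor is peeled first.
  keys : ℕ → List Key
  keys n = reverse (factorKeys n)

  keys-sorted : ∀ n → Sorted (keys n)
  keys-sorted n = AllPairs-reverse (AllPairs.++⁺
    (AllPairs-concatMap (λ k i → unmarked k , i) (λ k → ivl k (n ∸ 1))
      (λ k → AllPairs.map⁺ (AllPairs.map u≡u (ivl-ascending k (n ∸ 1)))) (λ _ _ → u≺u) (ivl-descending 1 (n ∸ 1)))
    (AllPairs-concatMap (λ k i → marked k , i) (λ k → reverse (ivl k (n ∸ 1)))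
      (λ k → AllPairs.map⁺ (AllPairs.map m≡m (ivl-descending k (n ∸ 1)))) (λ _ _ → m≺m) (ivl-ascending 1 (n ∸ 1)))
    (All.tabulate λ f∈ → All.tabulate λ g∈ → marked-last f∈ g∈))
    where
    marked-last : ∀ {f g} →
      f ∈ concatMap (λ k → map (λ i → (unmarked k , i)) (ivl k (n ∸ 1))) (reverse (ivl 1 (n ∸ 1))) →
      g ∈ concatMap (λ k → map (λ i → (marked k , i)) (reverse (ivl k (n ∸ 1)))) (ivl 1 (n ∸ 1)) → g ≺ f
    marked-last f∈ g∈
      with satisfied (∈-concatMap⁻ (λ k → map (λ i → (unmarked k , i)) (ivl k (n ∸ 1))) {xs = reverse (ivl 1 (n ∸ 1))} f∈)
         | satisfied (∈-concatMap⁻ (λ k → map (λ i → (marked k , i)) (reverse (ivl k (n ∸ 1)))) {xs = ivl 1 (n ∸ 1)} g∈)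
    ... | k , f∈′ | k′ , g∈′ with ∈-map⁻ (λ i → (unmarked k , i)) f∈′ | ∈-map⁻ (λ i → (marked k′ , i)) g∈′
    ... | _ , _ , refl | _ , _ , refl = m≺u

  ∈-keys⁻ : ∀ n {L d} → (L , d) ∈ keys n → 1 ≤ size L × size L ≤ d × d ≤ n ∸ 1
  ∈-keys⁻ n f∈ with ∈-++⁻ (concatMap (λ k → map (λ i → (unmarked k , i)) (ivl k (n ∸ 1))) (reverse (ivl 1 (n ∸ 1))))
                            (Any.reverse⁻ f∈)
  ... | inj₁ f∈₁ with find (∈-concatMap⁻ (λ k → map (λ i → (unmarked k , i)) (ivl k (n ∸ 1))) {xs = reverse (ivl 1 (n ∸ 1))} f∈₁)
  ... | k , k∈ , f∈₂ with ∈-map⁻ (λ i → (unmarked k , i)) f∈₂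
  ... | d , d∈ , refl = proj₁ (to (∈-ivl⇔ {1} {n ∸ 1}) (Any.reverse⁻ k∈)) , to ∈-ivl⇔ d∈
  ∈-keys⁻ n f∈ | inj₂ f∈₁ with find (∈-concatMap⁻ (λ k → map (λ i → (marked k , i)) (reverse (ivl k (n ∸ 1)))) {xs = ivl 1 (n ∸ 1)} f∈₁)
  ... | k , k∈ , f∈₂ with ∈-map⁻ (λ i → (marked k , i)) f∈₂
  ... | d , d∈ , refl = proj₁ (to ∈-ivl⇔ k∈) , to ∈-ivl⇔ (Any.reverse⁻ d∈)

  ∈-keys⁺ : ∀ n {L d} → 1 ≤ size L → size L ≤ d → d ≤ n ∸ 1 → (L , d) ∈ keys n
  ∈-keys⁺ n {unmarked k} p q r = Any.reverse⁺ (∈-++⁺ˡ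
    (∈-concatMap⁺ (λ k → map (λ i → (unmarked k , i)) (ivl k (n ∸ 1)))
      (lose (Any.reverse⁺ (from ∈-ivl⇔ (p , ≤-trans q r))) (∈-map⁺ (λ i → (unmarked k , i)) (from ∈-ivl⇔ (q , r))))))
  ∈-keys⁺ n {marked k} p q r = Any.reverse⁺ (∈-++⁺ʳ (concatMap _ (reverse (ivl 1 (n ∸ 1))))
    (∈-concatMap⁺ (λ k → map (λ i → (marked k , i)) (reverse (ivl k (n ∸ 1))))
      (lose (from ∈-ivl⇔ (p , ≤-trans q r)) (∈-map⁺ (λ i → (marked k , i)) (Any.reverse⁺ (from ∈-ivl⇔ (q , r)))))))

  -- Bitableaux as valid fillings

  ≺-trans : ∀ {f g h} → f ≺ g → g ≺ h → f ≺ h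
  ≺-trans (m≺m p) (m≺m q) = m≺m (<-trans q p)
  ≺-trans (m≺m p) (m≡m q) = m≺m p
  ≺-trans (m≺m p) m≺u     = m≺u
  ≺-trans (m≡m p) (m≺m q) = m≺m q
  ≺-trans (m≡m p) (m≡m q) = m≡m (<-trans p q)
  ≺-trans (m≡m p) m≺u     = m≺u
  ≺-trans m≺u     (u≺u q) = m≺u
  ≺-trans m≺u     (u≡u q) = m≺u
  ≺-trans (u≺u p) (u≺u q) = u≺u (<-trans p q)
  ≺-trans (u≺u p) (u≡u q) = u≺u p
  ≺-trans (u≡u p) (u≺u q) = u≺u q
  ≺-trans (u≡u p) (u≡u q) = u≡u (<-trans q p)

  ≺⇒≤P : ∀ {L L′ d e} → (L , d) ≺ (L′ , e) → L ≤P L′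
  ≺⇒≤P (m≺m h) = m≤m (<⇒≤ h)
  ≺⇒≤P (m≡m _) = m≤m ≤-refl
  ≺⇒≤P m≺u     = m≤u
  ≺⇒≤P (u≺u h) = u≤u (<⇒≤ h)
  ≺⇒≤P (u≡u _) = u≤u ≤-refl

  ≺⇒unmarked-≢ : ∀ {L L′ d e} → (L , d) ≺ (L′ , e) → d < e → IsUnmarked L → L ≢ L′
  ≺⇒unmarked-≢ (u≺u h) _   _ refl = <-irrefl refl h
  ≺⇒unmarked-≢ (u≡u h) d<e _ refl = <-asym h d<e

  ≺⇒marked-≢ : ∀ {L L′ d e} → (L , d) ≺ (L′ , e) → e < d → IsMarked L → L ≢ L′
  ≺⇒marked-≢ (m≺m h) _   _ refl = <-irrefl refl h
  ≺⇒marked-≢ (m≡m h) e<d _ refl = <-asym h e<d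

  row-≺ : ∀ {L L′ d e} → L ≤P L′ → (IsUnmarked L → IsUnmarked L′ → L ≢ L′) → d < e → (L , d) ≺ (L′ , e)
  row-≺ m≤u _ _ = m≺u
  row-≺ (m≤m h) _ d<e with m≤n⇒m<n∨m≡n h
  ... | inj₁ h′   = m≺m h′
  ... | inj₂ refl = m≡m d<e
  row-≺ (u≤u h) ne _ with m≤n⇒m<n∨m≡n h
  ... | inj₁ h′   = u≺u h′
  ... | inj₂ refl = ⊥-elim (ne _ _ refl)

  column-≺ : ∀ {L L′ d e} → L ≤P L′ → (IsMarked L → IsMarked L′ → L ≢ L′) → e < d → (L , d) ≺ (L′ , e)
  column-≺ m≤u _ _ = m≺u
  column-≺ (u≤u h) _ e<d with m≤n⇒m<n∨m≡n h
  ... | inj₁ h′   = u≺u h′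
  ... | inj₂ refl = u≡u e<d
  column-≺ (m≤m h) ne _ with m≤n⇒m<n∨m≡n h
  ... | inj₁ h′   = m≺m h′
  ... | inj₂ refl = ⊥-elim (ne _ _ refl)

  module Bitableaux {m} (n : ℕ) (la : Vec ℕ m) (pla : IsPartition la) (bound : part la 1 + m ≤ n)
                    (mu : Vec ℕ m) (pmu : IsPartition mu) where
    open Fillings la pla

    content-< : ∀ {k k′} j → k < k′ → k′ < m → content k′ j < content k j
    content-< j k<k′ k′<m = +-monoˡ-< j (∸-monoʳ-< (s≤s k<k′) k′<m)

    content≤n : ∀ {k j} → Cell mu k j → content k j ≤ n ∸ 1
    content≤n {k} {j} (k<m , _ , u) = ∸-monoˡ-≤ 1 (begin
      suc (m ∸ suc k) + j  ≡⟨ cong (_+ j) (+-∸-assoc 1 k<m) ⟨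
      (m ∸ k) + j          ≤⟨ +-mono-≤ (m∸n≤m m k) (≤-trans u (part-antitone la pla z≤n)) ⟩
      m + part la 1        ≡⟨ +-comm m _ ⟩
      part la 1 + m        ≤⟨ bound ⟩
      n                    ∎)
      where open ≤-Reasoning

    -- With i = k + 1, the flag μ_i + m + 1 - i of the marked letters is the content index of the
    -- first box of the row.
    lowerBound : ∀ k → k ≤ m → part mu (suc k) + m + 1 ∸ suc k ≡ bead mu k
    lowerBound k k≤m = trans (cong (_∸ suc k) (+-comm _ 1)) (+-∸-assoc (part mu (suc k)) k≤m)

    module _ {U : Filling} (val : Valid (keys n) mu U) where
      open Valid val

      row-sorted : ∀ {k j j′} → Cell mu k j → Cell mu k j′ → j < j′ → key mu U k j ≺ key mu U k j′
      row-sorted {j′ = suc j′} b b′@(k<m , _ , u) (s≤s j≤j′) with m≤n⇒m<n∨m≡n j≤j′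
      ... | inj₂ refl = right b b′
      ... | inj₁ j<j′ = ≺-trans (row-sorted b mid j<j′) (right mid b′)
        where mid = k<m , <-trans (proj₁ (proj₂ b)) j<j′ , ≤-trans (n≤1+n j′) u

      column-sorted : ∀ {k k′ j} → Cell mu k j → Cell mu k′ j → k < k′ → key mu U k j ≺ key mu U k′ j
      column-sorted {k′ = suc k′} b@(_ , l , _) b′@(k′<m , _ , u) (s≤s k≤k′) with m≤n⇒m<n∨m≡n k≤k′
      ... | inj₂ refl = down b b′
      ... | inj₁ k<k′ = ≺-trans (column-sorted b mid k<k′) (down mid b′)
        where mid = <-trans ≤-refl k′<m , ≤-<-trans (part-antitone mu pmu k≤k′) l , ≤-trans u (pla k′)

      private
        lower : ∀ {k} → Cell mu k (suc (part mu (suc k))) →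
          marked (bead mu k) ≤P entry mu U (suc k) (suc (part mu (suc k)))
        lower {k} b@(k<m , _) with entry mu U (suc k) (suc (part mu (suc k))) | ∈-keys⁻ n (key∈ b)
        ... | unmarked _ | _         = m≤u
        ... | marked _   | _ , h , _ = m≤m (≤-trans h (≤-reflexive (content-first mu k<m)))

        ≤P-trans : ∀ {a L M} → marked a ≤P L → L ≤P M → marked a ≤P M
        ≤P-trans (m≤m p) (m≤m q) = m≤m (≤-trans q p)
        ≤P-trans (m≤m p) m≤u     = m≤u
        ≤P-trans m≤u     (u≤u q) = m≤u

        ≤pred⇒< : ∀ {k n} → 1 ≤ k → k ≤ n ∸ 1 → suc k ≤ n
        ≤pred⇒< {n = zero}  (s≤s _) ()
        ≤pred⇒< {n = suc n} _       h = s≤s h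

      -- Membership in `keys n` bounds a marked entry by its own content index, which beyond the
      -- first box is weaker than the flag. The bound is therefore taken at the first box and
      -- carried along the row by the order of the entries.
      valid⇒lower : ∀ {k j} → Cell mu k j → marked (part mu (suc k) + m + 1 ∸ suc k) ≤P entry mu U (suc k) j
      valid⇒lower {k} {j} b@(k<m , l , u) rewrite lowerBound k (<⇒≤ k<m) with m≤n⇒m<n∨m≡n l
      ... | inj₁ h    = ≤P-trans (lower first) (≺⇒≤P (row-sorted first b h))
        where
        first : Cell mu k (suc (part mu (suc k)))
        first = k<m , ≤-refl , ≤-trans l u
      ... | inj₂ refl = lower b
      -- Here the box's own bound is enough: its content index is at most that of the last box of
      -- the row, which is the flag λ_i + m - i.
      valid⇒upper : ∀ {k j} → Cell mu k j → entry mu U (suc k) j ≤P unmarked (part la (suc k) + m ∸ suc k)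
      valid⇒upper {k} {j} b@(k<m , _ , u) with entry mu U (suc k) j | ∈-keys⁻ n (key∈ b)
      ... | marked _   | _         = m≤u
      ... | unmarked _ | _ , h , _ = u≤u (begin
        _                              ≤⟨ h ⟩
        m ∸ suc k + j                  ≤⟨ +-monoʳ-≤ (m ∸ suc k) u ⟩
        m ∸ suc k + part la (suc k)    ≡⟨ +-comm (m ∸ suc k) _ ⟩
        part la (suc k) + (m ∸ suc k)  ≡⟨ +-∸-assoc (part la (suc k)) k<m ⟨
        part la (suc k) + m ∸ suc k    ∎)
        where open ≤-Reasoning

      valid⇒InP : ∀ {k j} → Cell mu k j → InP n (entry mu U (suc k) j)
      valid⇒InP {k} {j} b with entry mu U (suc k) j | ∈-keys⁻ n (key∈ b)
      ... | marked _   | p , q , r = inM p (≤pred⇒< p (≤-trans q r))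
      ... | unmarked _ | p , q , r = inU p (≤pred⇒< p (≤-trans q r))

      valid⇒bitableau : IsBitableau n m la mu U
      valid⇒bitableau = record
        { rowsCount  = rows
        ; rowLength  = λ { (suc k) _ k<m → rowLen k k<m }
        ; inAlphabet = λ { (suc k) j (_ , b) → valid⇒InP b }
        ; rowWeak    = λ { (suc k) j j′ (_ , b) (_ , b′) j<j′ → ≺⇒≤P (row-sorted b b′ j<j′) }
        ; rowStrict  = λ { (suc k) j j′ (_ , b) (_ , b′) j<j′ un _ →
                           ≺⇒unmarked-≢ (row-sorted b b′ j<j′) (+-monoʳ-< (m ∸ suc k) j<j′) un }
        ; colWeak    = λ { (suc k) (suc k′) j (_ , b) (_ , b′) (s≤s k<k′) → ≺⇒≤P (column-sorted b b′ k<k′) }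
        ; colStrict  = λ { (suc k) (suc k′) j (_ , b) (_ , b′) (s≤s k<k′) ma _ →
                           ≺⇒marked-≢ (column-sorted b b′ k<k′) (content-< j k<k′ (proj₁ b′)) ma }
        ; rowLower   = λ { (suc k) j (_ , b) → valid⇒lower b }
        ; rowUpper   = λ { (suc k) j (_ , b) → valid⇒upper b }
        }

    module _ {U : Filling} (bi : IsBitableau n m la mu U) where
      open IsBitableau bi

      private
        box : ∀ {k j} → Cell mu k j → Box m la mu (suc k) j
        box b = s≤s z≤n , b

        size-pos : ∀ {L} → InP n L → 1 ≤ size L
        size-pos (inM h _) = h
        size-pos (inU h _) = h

      -- Unmarked entries strictly increase along a row, so the bound at its last box propagates to the left.
      unmarked-≤-content : ∀ r {k j a} → j + r ≡ part la (suc k) → Cell mu k j →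
        entry mu U (suc k) j ≡ unmarked a → a ≤ content k j
      unmarked-≤-content zero {k} {j} {a} e b@(k<m , _) eq with subst (_≤P _) eq (rowUpper (suc k) j (box b))
      ... | u≤u h = ≤-trans h (≤-reflexive (begin
        part la (suc k) + m ∸ suc k    ≡⟨ +-∸-assoc (part la (suc k)) k<m ⟩
        part la (suc k) + (m ∸ suc k)  ≡⟨ +-comm (part la (suc k)) _ ⟩
        (m ∸ suc k) + part la (suc k)  ≡⟨ cong (m ∸ suc k +_) (trans (sym e) (+-identityʳ j)) ⟩
        content k j                    ∎))
        where open ≡-Reasoning
      unmarked-≤-content (suc r) {k} {j} {a} e b@(k<m , l , _) eq = next (entry mu U (suc k) (suc j)) refl
        where
        b′ : Cell mu k (suc j)
        b′ = k<m , m<n⇒m<1+n l , ≤-trans (m≤m+n (suc j) r) (≤-reflexive (trans (sym (+-suc j r)) e))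
        weak = subst (_≤P entry mu U (suc k) (suc j)) eq (rowWeak (suc k) j (suc j) (box b) (box b′) ≤-refl)
        strict = rowStrict (suc k) j (suc j) (box b) (box b′) ≤-refl
        next : ∀ L → entry mu U (suc k) (suc j) ≡ L → a ≤ content k j
        next (marked c) eq′ with () ← subst (unmarked a ≤P_) eq′ weak
        next (unmarked c) eq′ with subst (unmarked a ≤P_) eq′ weak
        ... | u≤u a≤c = ≤-pred (≤-trans (≤∧≢⇒< a≤c a≢c)
                (≤-trans (unmarked-≤-content r (trans (sym (+-suc j r)) e) b′ eq′) (≤-reflexive (+-suc _ j))))
          where
          a≢c : a ≢ c
          a≢c refl = strict (subst IsUnmarked (sym eq) _) (subst IsUnmarked (sym eq′) _) (trans eq (sym eq′))

      -- For marked letters the flag is the content index of the first box and so bounds every box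
      -- of the row. For unmarked letters the flag is attained only at the last box, and strictness
      -- along the row has to make up the difference.
      size-≤-content : ∀ {k j} → Cell mu k j → size (entry mu U (suc k) j) ≤ content k j
      size-≤-content {k} {j} b@(k<m , l , u) = by (entry mu U (suc k) j) refl
        where
        by : ∀ L → entry mu U (suc k) j ≡ L → size L ≤ content k j
        by (unmarked a) eq = unmarked-≤-content _ (m+[n∸m]≡n u) b eq
        by (marked a)   eq with subst (_ ≤P_) eq (rowLower (suc k) j (box b))
        ... | m≤m h = ≤-trans h (begin
          part mu (suc k) + m + 1 ∸ suc k       ≡⟨ lowerBound k (<⇒≤ k<m) ⟩
          bead mu k                             ≡⟨ content-first mu k<m ⟨
          content k (suc (part mu (suc k)))     ≤⟨ +-monoʳ-≤ (m ∸ suc k) l ⟩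
          content k j                           ∎)
          where open ≤-Reasoning

      bitableau⇒valid : Valid (keys n) mu U
      bitableau⇒valid = record
        { rows   = rowsCount
        ; rowLen = λ k k<m → rowLength (suc k) (s≤s z≤n) k<m
        ; key∈   = λ b → ∈-keys⁺ n (size-pos (inAlphabet _ _ (box b))) (size-≤-content b) (content≤n b)
        ; right  = λ {k} {j} b b′ → row-≺ (rowWeak _ _ _ (box b) (box b′) ≤-refl)
                     (rowStrict _ _ _ (box b) (box b′) ≤-refl) (+-monoʳ-< (m ∸ suc k) ≤-refl)
        ; down   = λ {k} {j} b b′ → column-≺ (colWeak _ _ _ (box b) (box b′) ≤-refl)
                     (colStrict _ _ _ (box b) (box b′) ≤-refl) (content-< j ≤-refl (proj₁ b′))
        }

open Combinatorics

-- Coefficients in the nilCoxeter algebra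

rmulS-involutive : ∀ w i → rmulS (rmulS w i) i ≡ w
rmulS-involutive w i = swapAt-involutive w _

val-rmulS : ∀ {w i} → 0 < i → i < length w →
  val (rmulS w i) i ≡ val w (suc i) × val (rmulS w i) (suc i) ≡ val w i
val-rmulS {w} {suc p} _ h = lookupD-swapAt 0 w p h

module Coefficients {c ℓ : Level} (R : CommutativeRing c ℓ) where
  open CommutativeRing R
  open NilCoxeter R
  open import Algebra.Properties.CommutativeSemigroup +-commutativeSemigroup using (interchange)
  open import Relation.Binary.Reasoning.Setoid setoid

  private
    _≟ᵖ_ : (w v : Perm) → Dec (w ≡ v)
    _≟ᵖ_ = List.≡-dec ℕ._≟_

    single : Perm → Carrier → Perm → Carrier
    single w a v = if does (w ≟ᵖ v) then a else 0#

    coeff-∷ : ∀ w a α v → coeff ((w , a) ∷ α) v ≈ single w a v + coeff α v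
    coeff-∷ w a α v with w ≟ᵖ v
    ... | yes _ = refl
    ... | no _  = sym (+-identityˡ _)

    single-≢ : ∀ {w a v} → w ≢ v → single w a v ≡ 0#
    single-≢ {w} {a} {v} ne rewrite dec-false (w ≟ᵖ v) ne = ≡.refl

    single-rmulS : ∀ w a t v i → single (rmulS w i) (a * t) v ≈ single w a (rmulS v i) * t
    single-rmulS w a t v i with rmulS w i ≟ᵖ v
    ... | yes e rewrite dec-true (w ≟ᵖ rmulS v i) (≡.trans (≡.sym (rmulS-involutive w i)) (≡.cong (λ u → rmulS u i) e))
        = refl
    ... | no ne rewrite dec-false (w ≟ᵖ rmulS v i) (λ e → ne (≡.trans (≡.cong (λ u → rmulS u i) e) (rmulS-involutive v i)))
        = sym (zeroˡ t)

    rmulFactor-ascent : ∀ t i w a α → val w i < val w (suc i) →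
      rmulFactor t i ((w , a) ∷ α) ≡ (w , a) ∷ (rmulS w i , a * t) ∷ rmulFactor t i α
    rmulFactor-ascent t i w a α h rewrite dec-true (val w i <? val w (suc i)) h = ≡.refl

    rmulFactor-descent : ∀ t i w a α → ¬ (val w i < val w (suc i)) →
      rmulFactor t i ((w , a) ∷ α) ≡ (w , a) ∷ rmulFactor t i α
    rmulFactor-descent t i w a α h rewrite dec-false (val w i <? val w (suc i)) h = ≡.refl

  module _ (t : Carrier) {i : ℕ} {v : Perm} (0<i : 0 < i) (i<len : i < length v) where

    -- The summand ξ_w ξ_i can reach ξ_v only from w = v s_i. Since v descends at i, this w ascends
    -- there and the product does not vanish; a w without ascent at i differs from v s_i and adds
    -- nothing.
    coeff-rmulFactor-descent : val v (suc i) < val v i → ∀ α →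
      coeff (rmulFactor t i α) v ≈ coeff α v + coeff α (rmulS v i) * t
    coeff-rmulFactor-descent d []            = sym (trans (+-identityˡ _) (zeroˡ t))
    coeff-rmulFactor-descent d ((w , a) ∷ α) = begin
      coeff (rmulFactor t i ((w , a) ∷ α)) v
        ≈⟨ head (val w i <? val w (suc i)) ⟩
      (single w a v + single w a (rmulS v i) * t) + coeff (rmulFactor t i α) v
        ≈⟨ +-congˡ (coeff-rmulFactor-descent d α) ⟩
      (single w a v + single w a (rmulS v i) * t) + (coeff α v + coeff α (rmulS v i) * t)
        ≈⟨ interchange _ _ _ _ ⟩
      (single w a v + coeff α v) + (single w a (rmulS v i) * t + coeff α (rmulS v i) * t)
        ≈⟨ +-cong (coeff-∷ w a α v) (trans (*-congʳ (coeff-∷ w a α (rmulS v i))) (distribʳ t _ _)) ⟨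
      coeff ((w , a) ∷ α) v + coeff ((w , a) ∷ α) (rmulS v i) * t ∎
      where
      head : Dec (val w i < val w (suc i)) → coeff (rmulFactor t i ((w , a) ∷ α)) v
        ≈ (single w a v + single w a (rmulS v i) * t) + coeff (rmulFactor t i α) v
      head (yes asc) = begin
        coeff (rmulFactor t i ((w , a) ∷ α)) v
          ≡⟨ ≡.cong (λ β → coeff β v) (rmulFactor-ascent t i w a α asc) ⟩
        coeff ((w , a) ∷ (rmulS w i , a * t) ∷ rmulFactor t i α) v
          ≈⟨ trans (coeff-∷ w a ((rmulS w i , a * t) ∷ rmulFactor t i α) v) (+-congˡ (coeff-∷ (rmulS w i) (a * t) (rmulFactor t i α) v)) ⟩
        single w a v + (single (rmulS w i) (a * t) v + coeff (rmulFactor t i α) v)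
          ≈⟨ trans (sym (+-assoc _ _ _)) (+-congʳ (+-congˡ (single-rmulS w a t v i))) ⟩
        (single w a v + single w a (rmulS v i) * t) + coeff (rmulFactor t i α) v ∎
      head (no ¬asc) = begin
        coeff (rmulFactor t i ((w , a) ∷ α)) v
          ≡⟨ ≡.cong (λ β → coeff β v) (rmulFactor-descent t i w a α ¬asc) ⟩
        coeff ((w , a) ∷ rmulFactor t i α) v
          ≈⟨ coeff-∷ w a (rmulFactor t i α) v ⟩
        single w a v + coeff (rmulFactor t i α) v
          ≈⟨ +-congʳ (trans (+-congˡ (trans (*-congʳ (reflexive (single-≢ w≢))) (zeroˡ t))) (+-identityʳ _)) ⟨
        (single w a v + single w a (rmulS v i) * t) + coeff (rmulFactor t i α) v ∎
        where
        w≢ : w ≢ rmulS v i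
        w≢ ≡.refl with val-rmulS {v} 0<i i<len
        ... | e , e′ = ¬asc (≡.subst₂ _<_ (≡.sym e) (≡.sym e′) d)

    -- Every new word w s_i arises from an ascent of w at i, so it descends at i and cannot be v.
    coeff-rmulFactor-ascent : ¬ (val v (suc i) < val v i) → ∀ α →
      coeff (rmulFactor t i α) v ≈ coeff α v
    coeff-rmulFactor-ascent ¬d []            = refl
    coeff-rmulFactor-ascent ¬d ((w , a) ∷ α) = begin
      coeff (rmulFactor t i ((w , a) ∷ α)) v     ≈⟨ head (val w i <? val w (suc i)) ⟩
      single w a v + coeff (rmulFactor t i α) v  ≈⟨ +-congˡ (coeff-rmulFactor-ascent ¬d α) ⟩
      single w a v + coeff α v                   ≈⟨ coeff-∷ w a α v ⟨
      coeff ((w , a) ∷ α) v ∎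
      where
      head : Dec (val w i < val w (suc i)) →
        coeff (rmulFactor t i ((w , a) ∷ α)) v ≈ single w a v + coeff (rmulFactor t i α) v
      head (no ¬asc) = trans (reflexive (≡.cong (λ β → coeff β v) (rmulFactor-descent t i w a α ¬asc))) (coeff-∷ w a (rmulFactor t i α) v)
      head (yes asc) = begin
        coeff (rmulFactor t i ((w , a) ∷ α)) v
          ≡⟨ ≡.cong (λ β → coeff β v) (rmulFactor-ascent t i w a α asc) ⟩
        coeff ((w , a) ∷ (rmulS w i , a * t) ∷ rmulFactor t i α) v
          ≈⟨ trans (coeff-∷ w a ((rmulS w i , a * t) ∷ rmulFactor t i α) v) (+-congˡ (coeff-∷ (rmulS w i) (a * t) (rmulFactor t i α) v)) ⟩
        single w a v + (single (rmulS w i) (a * t) v + coeff (rmulFactor t i α) v)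
          ≈⟨ +-congˡ (trans (+-congʳ (reflexive (single-≢ ws≢))) (+-identityˡ _)) ⟩
        single w a v + coeff (rmulFactor t i α) v ∎
        where
        ws≢ : rmulS w i ≢ v
        ws≢ ≡.refl with val-rmulS {w} 0<i (≡.subst (i <_) (length-swapAt w _) i<len)
        ... | e , e′ = ¬d (≡.subst₂ _<_ (≡.sym e′) (≡.sym e) asc)

  coeff-one-≡ : ∀ {n v} → idPerm n ≡ v → coeff (one n) v ≈ 1#
  coeff-one-≡ {n} {v} e rewrite dec-true (idPerm n ≟ᵖ v) e = +-identityʳ 1#

  coeff-one-≢ : ∀ {n v} → idPerm n ≢ v → coeff (one n) v ≡ 0#
  coeff-one-≢ {n} {v} ne = single-≢ ne

-- Expanding the coefficient along the factors

module Expansion {c ℓ : Level} (R : CommutativeRing c ℓ) (x y : ℕ → CommutativeRing.Carrier R) where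
  open CommutativeRing R renaming (refl to ≈-refl; trans to ≈-trans; sym to ≈-sym)
  open NilCoxeter R
  open Weights R
  open Coefficients R
  open import Algebra.Properties.CommutativeSemigroup +-commutativeSemigroup
    using () renaming (x∙yz≈y∙xz to x+[y+z]≈y+[x+z])
  open import Relation.Binary.Reasoning.Setoid setoid

  sumR-++ : ∀ as bs → sumR (as ++ bs) ≈ sumR as + sumR bs
  sumR-++ []       bs = ≈-sym (+-identityˡ _)
  sumR-++ (a ∷ as) bs = ≈-trans (+-congˡ (sumR-++ as bs)) (≈-sym (+-assoc _ _ _))

  sumR-map-↭ : ∀ {A : Set} (f : A → Carrier) {as bs} → as ↭ bs → sumR (map f as) ≈ sumR (map f bs)
  sumR-map-↭ f ↭.refl         = ≈-refl
  sumR-map-↭ f (↭.prep a p)   = +-congˡ (sumR-map-↭ f p)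
  sumR-map-↭ f (↭.swap a b p) = ≈-trans (+-congˡ (+-congˡ (sumR-map-↭ f p))) (x+[y+z]≈y+[x+z] _ _ _)
  sumR-map-↭ f (↭.trans p q)  = ≈-trans (sumR-map-↭ f p) (sumR-map-↭ f q)

  sumR-map-* : ∀ {A : Set} (f g : A → Carrier) t {as} → All (λ a → f a ≈ g a * t) as →
    sumR (map f as) ≈ sumR (map g as) * t
  sumR-map-* f g t []       = ≈-sym (zeroˡ t)
  sumR-map-* f g t (e ∷ es) = ≈-trans (+-cong e (sumR-map-* f g t es)) (≈-sym (distribʳ t _ _))

  private
    w : Letter → Carrier
    w = letterWeight x y
    wt : Filling → Carrier
    wt = weight x y

  weight-++ : ∀ r U → wt (r ∷ U) ≈ wt (r ∷ []) * wt U
  weight-++ []      U = ≈-sym (*-identityˡ _)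
  weight-++ (L ∷ r) U = ≈-trans (*-congˡ (weight-++ r U)) (≈-sym (*-assoc _ _ _))

  -- The bound on k matters: past the last row `consAt` drops the letter, and its weight would be
  -- lost.
  weight-consAt : ∀ k L U → k < len U → wt (consAt k L U) ≈ wt U * w L
  weight-consAt zero    L (r ∷ U) _       = *-comm _ _
  weight-consAt (suc k) L (r ∷ U) (s≤s h) = begin
    wt (r ∷ consAt k L U)           ≈⟨ weight-++ r (consAt k L U) ⟩
    wt (r ∷ []) * wt (consAt k L U) ≈⟨ *-congˡ (weight-consAt k L U h) ⟩
    wt (r ∷ []) * (wt U * w L)      ≈⟨ *-assoc _ _ _ ⟨
    wt (r ∷ []) * wt U * w L        ≈⟨ *-congʳ (weight-++ r U) ⟨
    wt (r ∷ U) * w L                ∎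

  weight-empty : ∀ m → wt (replicate m []) ≡ 1#
  weight-empty zero    = ≡.refl
  weight-empty (suc m) = weight-empty m

  factorProduct : ℕ → List Key → Elem
  factorProduct n = foldr (λ f → rmulFactor (w (proj₁ f)) (proj₂ f)) (one n)

  product≡factorProduct : ∀ n → product n x y ≡ factorProduct n (keys n)
  product≡factorProduct n = ≡.trans (≡.cong (foldl _ (one n)) factors≡)
    (≡.trans (List.foldl-map (λ α f → rmulFactor (proj₁ f) (proj₂ f) α) weigh (one n) (factorKeys n))
      (≡.sym (List.reverse-foldr (λ f → rmulFactor (w (proj₁ f)) (proj₂ f)) (one n) (factorKeys n))))
    where
    weigh : Key → Carrier × ℕ
    weigh (L , i) = w L , i
    factors≡ : factors n x y ≡ map weigh (factorKeys n)
    factors≡ = ≡.sym (≡.trans (List.map-++ weigh (concatMap (λ k → map (λ i → (unmarked k , i)) (ivl k (n ℕ.∸ 1))) (reverse (ivl 1 (n ℕ.∸ 1)))) _)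
      (≡.cong₂ _++_
        (≡.trans (List.map-concatMap weigh _ (reverse (ivl 1 (n ℕ.∸ 1))))
          (List.concatMap-cong (λ k → ≡.sym (List.map-∘ (ivl k (n ℕ.∸ 1)))) (reverse (ivl 1 (n ℕ.∸ 1)))))
        (≡.trans (List.map-concatMap weigh _ (ivl 1 (n ℕ.∸ 1)))
          (List.concatMap-cong (λ k → ≡.sym (List.map-∘ (reverse (ivl k (n ℕ.∸ 1))))) (ivl 1 (n ℕ.∸ 1))))))

  module _ {m} (n : ℕ) (la : Vec ℕ m) (pla : IsPartition la) (bound : part la 1 ℕ.+ m ≤ n) where
    open SkewValues n la pla bound
    open Fillings la pla

    -- Induction on the factors with μ varying and λ fixed. Both sides branch on the same decision
    -- `addable?`: on the left it selects the descent or the ascent rule for coefficients, on the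
    -- right it is the recursion of `fillings`.
    coeff-factorProduct : ∀ fs mu → Sorted fs → All (λ f → 0 < proj₂ f × proj₂ f < n) fs →
      IsPartition mu → Contains la mu →
      coeff (factorProduct n fs) (skewPerm m n la mu) ≈ sumR (map wt (fillings fs mu))
    coeff-factorProduct [] mu _ _ pmu c with Vec.≡-dec ℕ._≟_ mu la
    ... | yes ≡.refl = ≈-trans (coeff-one-≡ skewPerm-self)
            (≈-trans (≈-sym (reflexive (weight-empty m))) (≈-sym (+-identityʳ _)))
    ... | no ne = reflexive (coeff-one-≢ (skewPerm-≢ mu pmu c ne))
    coeff-factorProduct ((L , i) ∷ fs) mu (_ ∷ sorted) ((0<i , i<n) ∷ range) pmu c with addable? la mu i
    ... | yes (k , a) = begin
      coeff (rmulFactor (w L) i α) v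
        ≈⟨ coeff-rmulFactor-descent (w L) 0<i i<len descent α ⟩
      coeff α v + coeff α (rmulS v i) * w L
        ≈⟨ +-cong (coeff-factorProduct fs mu sorted range pmu c) (*-congʳ (begin
             coeff α (rmulS v i)                      ≡⟨ ≡.cong (coeff α) (skewPerm-increment pmu a) ⟩
             coeff α (skewPerm m n la (increment k mu))
               ≈⟨ coeff-factorProduct fs (increment k mu) sorted range (increment-partition mu pmu a) (increment-contains c a) ⟩
             sumR (map wt (fillings fs (increment k mu))) ∎)) ⟩
      sumR (map wt (fillings fs mu)) + sumR (map wt (fillings fs (increment k mu))) * w L
        ≈⟨ +-congˡ (≈-trans (reflexive (≡.cong sumR (≡.sym (List.map-∘ (fillings fs (increment k mu)))))) (sumR-map-* (wt ∘ consAt k L) wt (w L)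
             (All.tabulate λ {U} U∈ → weight-consAt k L U (≡.subst (k <_) (≡.sym (Valid.rows
               (fillings-sound fs (increment k mu) sorted (increment-partition mu pmu a) U∈))) (Addable.row< a))))) ⟨
      sumR (map wt (fillings fs mu)) + sumR (map wt (map (consAt k L) (fillings fs (increment k mu))))
        ≈⟨ ≈-trans (reflexive (≡.cong sumR (List.map-++ wt (fillings fs mu) _))) (sumR-++ (map wt (fillings fs mu)) _) ⟨
      sumR (map wt (fillings fs mu ++ map (consAt k L) (fillings fs (increment k mu)))) ∎
      where
      α = factorProduct n fs
      v = skewPerm m n la mu
      i<len : i < length v
      i<len = ≡.subst (i <_) (≡.sym (length-skewPerm mu)) i<n
      descent : val v (suc i) < val v i
      descent = ≡.subst₂ _<_ (≡.sym (val-skewPerm mu (s≤s z≤n) i<n))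
        (≡.sym (val-skewPerm mu 0<i (ℕ.≤-trans (ℕ.n≤1+n i) i<n))) (addable⇒descent pmu c a)
    ... | no ¬a = begin
      coeff (rmulFactor (w L) i α) v
        ≈⟨ coeff-rmulFactor-ascent (w L) 0<i i<len ascent α ⟩
      coeff α v
        ≈⟨ coeff-factorProduct fs mu sorted range pmu c ⟩
      sumR (map wt (fillings fs mu))
        ≡⟨ ≡.cong (sumR ∘ map wt) (List.++-identityʳ (fillings fs mu)) ⟨
      sumR (map wt (fillings fs mu ++ [])) ∎
      where
      α = factorProduct n fs
      v = skewPerm m n la mu
      i<len : i < length v
      i<len = ≡.subst (i <_) (≡.sym (length-skewPerm mu)) i<n
      ascent : ¬ (val v (suc i) < val v i)
      ascent h = ¬a (descent⇒addable pmu c 0<i i<n (≡.subst₂ _<_ (val-skewPerm mu (s≤s z≤n) i<n)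
        (val-skewPerm mu 0<i (ℕ.≤-trans (ℕ.n≤1+n i) i<n)) h))

-- Comparison with an arbitrary enumeration of the bitableaux

open import Data.Nat using (_+_)

theorem2p2 : {c ℓ : Level} (R : CommutativeRing c ℓ) →
    (m n : ℕ) → 1 ≤ m → 1 ≤ n →
    (la mu : Vec ℕ m) → IsPartition la → IsPartition mu → Contains la mu →
    part la 1 + m ≤ n →
    (x y : ℕ → CommutativeRing.Carrier R) →
    (Us : List Filling) → Unique Us →
    (∀ U → (U ∈ Us) ⇔ IsBitableau n m la mu U) →
    CommutativeRing._≈_ R
    (NilCoxeter.doubleSchubert R n x y (skewPerm m n la mu))
    (Weights.sumR R (map (Weights.weight R x y) Us))
theorem2p2 R m n _ 1≤n la mu pla pmu c bound x y Us unique iff = begin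
  coeff (product n x y) v               ≡⟨ ≡.cong (λ α → coeff α v) (product≡factorProduct n) ⟩
  coeff (factorProduct n (keys n)) v
    ≈⟨ coeff-factorProduct n la pla bound (keys n) mu (keys-sorted n) (All.tabulate indices) pmu c ⟩
  sumR (map (weight x y) (fillings (keys n) mu))
    -- `Us` is any enumeration without repetition. Two duplicate-free lists with the same members
    -- are permutations of each other, and the sum does not see the order.
    ≈⟨ sumR-map-↭ (weight x y) (∼bag⇒↭ (unique∧set⇒bag unique (fillings-unique (keys n) mu (keys-sorted n) pmu) members)) ⟨
  sumR (map (weight x y) Us)            ∎
  where
  open CommutativeRing R using (setoid)
  open NilCoxeter R
  open Weights R
  open Expansion R x y
  open Fillings la pla
  open Bitableaux n la pla bound mu pmu
  open import Relation.Binary.Reasoning.Setoid setoid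
  v = skewPerm m n la mu
  indices : ∀ {f} → f ∈ keys n → 0 < proj₂ f × proj₂ f < n
  indices {f} f∈ with ∈-keys⁻ n f∈
  ... | p , q , r = ℕ.≤-trans p q , ℕ.≤-trans (s≤s r) (ℕ.≤-reflexive (ℕ.m+[n∸m]≡n 1≤n))
  members : ∀ {U} → U ∈ Us ⇔ U ∈ fillings (keys n) mu
  members {U} = mk⇔
    (λ U∈ → fillings-complete (keys n) mu (keys-sorted n) pmu c (bitableau⇒valid (Equivalence.to (iff U) U∈)))
    (λ U∈ → Equivalence.from (iff U) (valid⇒bitableau (fillings-sound (keys n) mu (keys-sorted n) pmu U∈)))
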